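{- Let $G$ be a cyclically $4$-edge-connected cubic graph. Let $C$ be a $2$-factor of $G$ containing exactly two odd circuits $N_1$ and $N_2$ (and possibly some even circuits). Let $e=x_1x_2$ be an edge of $G$ with $x_1\in V(N_1)$ and $x_2\in V(N_2)$. Let $F=G-E(C)$ (the perfect matching complementary to $C$) and let $M$ be a maximum matching in $C-\{x_1,x_2\}$. For $i\in\{1,2\}$ let $Z_i$ be the set of edges of $N_i$ that are not incident with $x_i$ but are incident with a neighbour of $x_i$ on $N_i$. Suppose there exist a smooth orientation of the circuits of the subgraph with edge set $(E(F)\setminus\{e\})\cup M$ and a smooth orientation of $C$ which agree on all edges of $Z_1\cup Z_2$. Then $fn(G)=2$.
   Context: A circuit is a connected $2$-regular graph; a cycle is a graph in which every vertex has even degree. A graph is cyclically $k$-edge-connected if the removal of fewer than $k$ edges cannot separate it into two components that both contain a cycle. A smooth orientation of a set of edge-disjoint circuits is an orientation in which, for every circuit of the set, each vertex of that circuit has exactly one incoming and one outgoing edge of that circuit. An orientation is strong if for every ordered pair of distinct vertices $u,v$ there is a directed $uv$-path. An edge $e$ is deletable in an orientation $(G,o)$ if the restriction of $o$ to $E(G)\setminus\{e\}$ is a strong orientation of $G-e$. For a $3$-edge-connected graph $G$, the Frank number $fn(G)$ is the minimum number $k$ such that $G$ admits $k$ orientations with the property that every edge of $G$ is deletable in at least one of them. -}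

module Defs where

open import Data.Bool.Base using (Bool; true; false; not)
open import Data.Fin.Base using (Fin)
open import Data.Fin.Properties using (_≟_)
open import Data.Fin.Subset
  using (Subset; _∈_; _∉_; _⊆_; _∩_; _∪_; _─_; _-_; ⊤; ∁; ∣_∣; Nonempty)
open import Data.Nat.Base using (ℕ; _+_; _≤_; _<_)
open import Data.Nat.Divisibility using (_∣_; _∤_)
open import Data.Product.Base using (Σ-syntax; ∃-syntax; _×_)
open import Data.Vec.Base using (tabulate)
open import Relation.Binary.Construct.Closure.ReflexiveTransitive using (Star)
open import Relation.Binary.PropositionalEquality.Core using (_≡_; _≢_)
open import Relation.Nullary.Decidable.Core using (does)
open import Relation.Nullary.Negation.Core using (¬_)

-- Finite undirected graphs; loops and parallel edges are allowed.  The two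
-- ends of an edge are labelled by booleans, but this labelling carries no
-- meaning: it only serves to name the two possible directions of an edge.
record Graph : Set where
  field
    order : ℕ
    size  : ℕ
    end   : Fin size → Bool → Fin order

  Vertex  = Fin order
  Edge    = Fin size
  EdgeSet = Subset size

  -- A set H of edges stands for the spanning subgraph (V(G), H), or, when
  -- speaking of circuits, for the subgraph without its isolated vertices.

  fibre : (Edge → Vertex) → Vertex → EdgeSet
  fibre f v = tabulate λ e → does (f e ≟ v)

  incidentEdges : Vertex → EdgeSet
  incidentEdges v = fibre (λ e → end e false) v ∪ fibre (λ e → end e true) v

  -- A loop contributes 2.
  degree : EdgeSet → Vertex → ℕ
  degree H v = ∣ H ∩ fibre (λ e → end e false) v ∣
             + ∣ H ∩ fibre (λ e → end e true) v ∣

  _∈V_ : Vertex → EdgeSet → Set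
  v ∈V H = Nonempty (H ∩ incidentEdges v)

  Joins : Edge → Vertex → Vertex → Set
  Joins e u v = ∃[ b ] (end e b ≡ u × end e (not b) ≡ v)

  Adjacent : EdgeSet → Vertex → Vertex → Set
  Adjacent H u v = ∃[ e ] (e ∈ H × Joins e u v)

  Connected : EdgeSet → Vertex → Vertex → Set
  Connected H = Star (Adjacent H)

  Cubic : Set
  Cubic = ∀ v → degree ⊤ v ≡ 3

  IsTwoFactor : EdgeSet → Set
  IsTwoFactor C = ∀ v → degree C v ≡ 2

  record IsCircuit (K : EdgeSet) : Set where
    field
      nonempty  : Nonempty K
      regular   : ∀ v → v ∈V K → degree K v ≡ 2
      connected : ∀ u v → u ∈V K → v ∈V K → Connected K u v

  Odd : EdgeSet → Set
  Odd K = 2 ∤ ∣ K ∣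

  -- When H is 2-regular, these are the components of H.
  _CircuitOf_ : EdgeSet → EdgeSet → Set
  K CircuitOf H = IsCircuit K × K ⊆ H

  OddCircuitOf : EdgeSet → EdgeSet → Set
  OddCircuitOf C K = K CircuitOf C × Odd K

  IsCycle : EdgeSet → Set
  IsCycle K = ∀ v → 2 ∣ degree K v

  -- The component of H at v contains a cycle (with at least one edge).
  ComponentHasCycle : EdgeSet → Vertex → Set
  ComponentHasCycle H v =
    Σ[ K ∈ EdgeSet ]
      (IsCycle K × Nonempty K × K ⊆ H × (∀ u → u ∈V K → Connected H v u))

  -- With S = ∅ this includes that at most one component of G has a cycle.
  CyclicallyEdgeConnected : ℕ → Set
  CyclicallyEdgeConnected k =
    ¬ (Σ[ S ∈ EdgeSet ] ∃[ u ] ∃[ v ]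
        (∣ S ∣ < k × ¬ Connected (∁ S) u v ×
         ComponentHasCycle (∁ S) u × ComponentHasCycle (∁ S) v))

  deleteVertices : EdgeSet → Vertex → Vertex → EdgeSet
  deleteVertices H x y = H ─ (incidentEdges x ∪ incidentEdges y)

  IsMatching : EdgeSet → Set
  IsMatching M = ∀ v → degree M v ≤ 1

  record IsMaximumMatching (H M : EdgeSet) : Set where
    field
      matching : IsMatching M
      within   : M ⊆ H
      maximum  : ∀ M′ → IsMatching M′ → M′ ⊆ H → ∣ M′ ∣ ≤ ∣ M ∣

  -- The edge e is directed from end e (o e) to end e (not (o e)).  An
  -- orientation of a subgraph H is represented by any orientation of G
  -- extending it; values outside H are then irrelevant.
  Orientation : Set
  Orientation = Edge → Bool

  tail : Orientation → Edge → Vertex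
  tail o e = end e (o e)

  head : Orientation → Edge → Vertex
  head o e = end e (not (o e))

  outdegree : Orientation → EdgeSet → Vertex → ℕ
  outdegree o H v = ∣ H ∩ fibre (tail o) v ∣

  indegree : Orientation → EdgeSet → Vertex → ℕ
  indegree o H v = ∣ H ∩ fibre (head o) v ∣

  -- Smooth orientation of the set of all circuits of H; meant for H of
  -- maximum degree 2, where these circuits are edge-disjoint.
  IsSmooth : EdgeSet → Orientation → Set
  IsSmooth H o =
    ∀ K → K CircuitOf H → ∀ v → v ∈V K → indegree o K v ≡ 1 × outdegree o K v ≡ 1

  Arc : Orientation → EdgeSet → Vertex → Vertex → Set
  Arc o H u v = ∃[ e ] (e ∈ H × tail o e ≡ u × head o e ≡ v)

  IsStrong : Orientation → EdgeSet → Set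
  IsStrong o H = ∀ u v → u ≢ v → Star (Arc o H) u v

  Deletable : Orientation → Edge → Set
  Deletable o e = IsStrong o (⊤ - e)

  DeletableCover : ℕ → Set
  DeletableCover k =
    Σ[ o ∈ (Fin k → Orientation) ] (∀ e → ∃[ i ] Deletable (o i) e)

  -- fn(G) = k.  A graph with at least one edge that is not
  -- 3-edge-connected has no deletable cover, hence no Frank number.
  record IsFrankNumber (k : ℕ) : Set where
    field
      cover   : DeletableCover k
      minimal : ∀ j → DeletableCover j → k ≤ j

  Z : EdgeSet → Vertex → Edge → Set
  Z N x f =
    f ∈ N × f ∉ incidentEdges x × ∃[ y ] (Adjacent N x y × f ∈ incidentEdges y)

{-# OPTIONS --safe #-}
module Submission where

-- Let f₁ be the unit flow along o₁ on (E(F) ∖ {e}) ∪ M and f₂ the unit flow along o₂ on C,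
-- and let e be directed from x₁ to x₂.  Orient all other edges along f₁ + 2 f₂ in the first
-- orientation and along 2 f₁ − f₂ in the second.  If f is the only edge leaving X, the flow
-- entering X equals the flow value φ(f), so a small φ(f) forces a cut of at most three edges; by cyclic
-- 4-edge-connectivity that cut is the star of a vertex.  Hence edges with φ = 1 not leaving x₂
-- or entering x₁ are deletable.  This settles every edge but the one of o₂ leaving x₁ and the
-- one entering x₂: these have φ = 2 in the first orientation, and the matching edge following
-- or preceding them lies in Z₁ ∪ Z₂ and so has φ = 3, which excludes the remaining stars.
--
-- That f₁ is a flow needs M to cover every vertex but x₁ and x₂.  This is seen by comparing M
-- with the matching obtained by alternating along the circuits of C, starting at x₁ and x₂
-- on the odd ones.

open import Data.Bool.Base using (Bool; true; false; not; _∧_; _xor_; if_then_else_)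
import Data.Bool.Properties as Bool
open import Data.Empty using (⊥; ⊥-elim)
open import Data.Fin.Base using (Fin; zero; suc)
open import Data.Fin.Properties using (_≟_; any?)
open import Data.Fin.Subset
  using (Subset; _∈_; _∉_; _⊆_; _⊃_; _∩_; _∪_; _─_; _-_; ⊤; ∁; ⁅_⁆; ∣_∣; Nonempty)
open import Data.Fin.Subset.Induction using (⊃-wellFounded; Acc; acc)
open import Data.Fin.Subset.Properties
  using (_∈?_; ∈⊤; ⊆-antisym; p⊆p∪q; p─q⊆p; q⊆p∪q; x∈p∩q⁺; x∈p∩q⁻; x∈p∪q⁺; x∈p∪q⁻;
         x∈p∧x∉q⇒x∈p─q; x∈p∧x≢y⇒x∈p-y; x∈⁅x⁆; x∈⁅y⁆⇒x≡y; x∈∁p⇒x∉p; x∉p⇒x∈∁p)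
open import Data.List.Base using (List; []; _∷_; allFin)
open import Data.List.Membership.Propositional using () renaming (_∈_ to _∈ˡ_)
open import Data.List.Membership.Propositional.Properties using (∈-allFin)
open import Data.List.Relation.Unary.Any using (here; there)
open import Data.Nat.Base using (ℕ; zero; suc; _+_; _*_; _≤_; _<_; z≤n; s≤s; s≤s⁻¹)
open import Data.Nat.Divisibility using (_∣_; _∣0; _∣?_; divides; ∣-refl; ∣m+n∣m⇒∣n; ∣1⇒≡1)
open import Data.Nat.Properties hiding (_≟_)
open import Data.Nat.Tactic.RingSolver using (solve-∀)
open import Algebra.Properties.Semiring.Sum +-*-semiring
  using (sum; sum-cong-≗; ∑-distrib-+; ∑-comm; *-distribˡ-sum)
open import Data.Product.Base using (Σ-syntax; ∃-syntax; _×_; _,_; proj₁; proj₂)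
open import Data.Sum.Base using (_⊎_; inj₁; inj₂; [_,_]′)
open import Data.Vec.Base using ([]; _∷_; here; there; lookup; tabulate)
open import Data.Vec.Properties
  using ([]=⇒lookup; lookup⇒[]=; lookup-replicate; lookup-zipWith; lookup∘tabulate)
open import Defs
open import Function.Base using (_∘_; const)
open import Relation.Binary.Construct.Closure.ReflexiveTransitive
  using (Star; ε; _◅_; _◅◅_; gmap; reverse)
open import Relation.Binary.PropositionalEquality
  using (_≡_; _≢_; refl; sym; trans; cong; cong₂; subst; module ≡-Reasoning)
open import Relation.Nullary.Decidable using (Dec; does; yes; no; _×-dec_; ¬?; dec-true; dec-false)
open import Relation.Nullary.Negation using (¬_; contradiction)

-- The coefficients give every edge but `e` the value 1 in one of the two combinations: an edge of F
-- has values 1 and 2, an edge of `C` outside `M` has 2 and 1, and an edge of `M` has 3 and 1 where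
-- the smooth orientations agree, 1 and 3 where they do not. The obstacle is `e`. Both flows vanish
-- on it, so it may enter a set without contributing to the inflow. An edge of value 1 then allows
-- three crossing edges instead of two, and stars at the ends of `e` survive as possible
-- obstructions. As f₁ vanishes at x₁ and x₂, only edges of `C` outside `M` can be affected. Their
-- repair rests on a remark about `e`: an edge with the same tail or the same head as `e` cannot
-- leave a set that `e` enters. For such an edge the value 2 again allows only three crossing edges.
-- That one orientation is not enough follows from degrees: if every edge were deletable in it, a
-- vertex would have two outgoing and two incoming edges, but its degree is three.

private variable
  n : ℕ

-- Indicators, finite sums and subsets.

ι : Bool → ℕ
ι true  = 1
ι false = 0

ι≤1 : ∀ b → ι b ≤ 1
ι≤1 true  = ≤-refl
ι≤1 false = z≤n

ι-∧ : ∀ a b → ι (a ∧ b) ≡ ι a * ι b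
ι-∧ true  b = sym (+-identityʳ (ι b))
ι-∧ false b = refl

ι-not : ∀ b → ι b + ι (not b) ≡ 1
ι-not true  = refl
ι-not false = refl

infix 7 _==_

_==_ : Fin n → Fin n → Bool
i == j = does (i ≟ j)

==-refl : (i : Fin n) → i == i ≡ true
==-refl i = dec-true (i ≟ i) refl

≢⇒== : {i j : Fin n} → i ≢ j → i == j ≡ false
≢⇒== {i = i} {j} = dec-false (i ≟ j)

==⇒≡ : (i j : Fin n) → i == j ≡ true → i ≡ j
==⇒≡ i j eq with i ≟ j
... | yes i≡j = i≡j

does⇒ : {A : Set} (a? : Dec A) → does a? ≡ true → A
does⇒ (yes a) _ = a

true≢false : true ≢ false
true≢false ()

∧-true : ∀ {a b} → a ∧ b ≡ true → a ≡ true × b ≡ true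
∧-true {true} {true} _ = refl , refl

opaque
  ∑ : (Fin n → ℕ) → ℕ
  ∑ = sum

  ∑-cong : {f g : Fin n → ℕ} → (∀ i → f i ≡ g i) → ∑ f ≡ ∑ g
  ∑-cong = sum-cong-≗

  ∑-+ : (f g : Fin n → ℕ) → ∑ (λ i → f i + g i) ≡ ∑ f + ∑ g
  ∑-+ = ∑-distrib-+

  ∑-swap : ∀ {m} (f : Fin m → Fin n → ℕ) → ∑ (λ i → ∑ (f i)) ≡ ∑ (λ j → ∑ λ i → f i j)
  ∑-swap = ∑-comm

  *-∑ : ∀ x (f : Fin n → ℕ) → x * ∑ f ≡ ∑ (λ i → x * f i)
  *-∑ = *-distribˡ-sum

  ∑-mono : {f g : Fin n → ℕ} → (∀ i → f i ≤ g i) → ∑ f ≤ ∑ g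
  ∑-mono {0}     f≤g = z≤n
  ∑-mono {suc n} f≤g = +-mono-≤ (f≤g zero) (∑-mono (f≤g ∘ suc))

  ∑-zero : {f : Fin n → ℕ} → (∀ i → f i ≡ 0) → ∑ f ≡ 0
  ∑-zero {0}     f≡0 = refl
  ∑-zero {suc n} f≡0 = cong₂ _+_ (f≡0 zero) (∑-zero (f≡0 ∘ suc))

  ∑-support : {f : Fin n → ℕ} (i : Fin n) → (∀ j → j ≢ i → f j ≡ 0) → ∑ f ≡ f i
  ∑-support {f = f} zero f≡0 =
    trans (cong (f zero +_) (∑-zero λ j → f≡0 (suc j) λ ())) (+-identityʳ _)
  ∑-support (suc i) f≡0 =
    cong₂ _+_ (f≡0 zero λ ()) (∑-support i λ j j≢i → f≡0 (suc j) λ { refl → j≢i refl })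

  ∑-δ : (i : Fin n) (c : ℕ) → ∑ (λ j → ι (j == i) * c) ≡ c
  ∑-δ i c = trans
    (∑-support i λ j j≢i → cong (λ b → ι b * c) (≢⇒== j≢i))
    (trans (cong (λ b → ι b * c) (==-refl i)) (+-identityʳ c))

  term≤∑ : (f : Fin n → ℕ) (i : Fin n) → f i ≤ ∑ f
  term≤∑ f zero    = m≤m+n _ _
  term≤∑ f (suc i) = ≤-trans (term≤∑ (f ∘ suc) i) (m≤n+m _ _)

  two-terms≤∑ : (f : Fin n → ℕ) {i j : Fin n} → i ≢ j → f i + f j ≤ ∑ f
  two-terms≤∑ f {zero}  {zero}  i≢j = contradiction refl i≢j
  two-terms≤∑ f {zero}  {suc j} i≢j = +-monoʳ-≤ (f zero) (term≤∑ (f ∘ suc) j)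
  two-terms≤∑ f {suc i} {zero}  i≢j =
    ≤-trans (≤-reflexive (+-comm (f (suc i)) _)) (+-monoʳ-≤ (f zero) (term≤∑ (f ∘ suc) i))
  two-terms≤∑ f {suc i} {suc j} i≢j =
    ≤-trans (two-terms≤∑ (f ∘ suc) (i≢j ∘ cong suc)) (m≤n+m _ _)

  -- A single strict inequality would separate the totals. This turns global counts into equalities
  -- at each vertex or edge.
  ∑-squeeze : {f g : Fin n → ℕ} → (∀ i → f i ≤ g i) → ∑ g ≤ ∑ f → ∀ i → f i ≡ g i
  ∑-squeeze {f = f} {g} f≤g Σg≤Σf zero = ≤-antisym (f≤g zero)
    (+-cancelʳ-≤ _ _ _ (≤-trans Σg≤Σf (+-monoʳ-≤ (f zero) (∑-mono (f≤g ∘ suc)))))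
  ∑-squeeze {f = f} {g} f≤g Σg≤Σf (suc i) = ∑-squeeze (f≤g ∘ suc)
    (+-cancelˡ-≤ _ _ _ (≤-trans Σg≤Σf (+-monoˡ-≤ _ (f≤g zero)))) i

  -- Stands in for signed sums: an identity with subtractions is kept in ℕ by moving the negative
  -- terms to the other side.
  ∑-balance : {f g h k : Fin n → ℕ} → (∀ i → f i + g i ≡ h i + k i) →
                ∑ f + ∑ g ≡ ∑ h + ∑ k
  ∑-balance {f = f} {g} {h} {k} eq =
    trans (sym (∑-+ f g)) (trans (∑-cong eq) (∑-+ h k))

  card : (p : Subset n) → ∣ p ∣ ≡ ∑ (λ i → ι (lookup p i))
  card []          = refl
  card (true  ∷ p) = cong suc (card p)
  card (false ∷ p) = card p

∑-witness : (b : Fin n → Bool) → 1 ≤ ∑ (ι ∘ b) → ∃[ i ] b i ≡ true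
∑-witness b 1≤Σ with any? (λ i → b i Bool.≟ true)
... | yes bi = bi
... | no ¬∃  = contradiction (≤-trans 1≤Σ (≤-reflexive (∑-zero λ i →
                 cong ι (Bool.¬-not λ bi → ¬∃ (i , bi))))) λ ()

∑-unique : (b : Fin n → Bool) → ∑ (ι ∘ b) ≡ 1 →
           ∃[ i ] (b i ≡ true × ∀ j → b j ≡ true → j ≡ i)
∑-unique b Σ≡1 with ∑-witness b (≤-reflexive (sym Σ≡1))
... | i , bi = i , bi , unique
  where
  unique : ∀ j → b j ≡ true → j ≡ i
  unique j bj with j ≟ i
  ... | yes j≡i = j≡i
  ... | no  j≢i = contradiction
    (≤-trans (≤-reflexive (sym (cong₂ (λ x y → ι x + ι y) bj bi)))
      (≤-trans (two-terms≤∑ (ι ∘ b) j≢i) (≤-reflexive Σ≡1)))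
    λ { (s≤s ()) }

∑-singleton : ∀ {n} (b : Fin n → Bool) → ∑ (ι ∘ b) ≡ 1 →
              ∀ {i j} → b i ≡ true → b j ≡ true → i ≡ j
∑-singleton b Σ≡1 bi bj with ∑-unique b Σ≡1
... | _ , _ , unique = trans (unique _ bi) (sym (unique _ bj))

∑-remove : (b : Fin n → Bool) {i : Fin n} → b i ≡ true →
           ∑ (ι ∘ b) ≡ suc (∑ λ j → ι (b j ∧ not (j == i)))
∑-remove b {i} bi = trans (∑-cong term)
  (trans (∑-+ (λ j → ι (j == i) * 1) (λ j → ι (b j ∧ not (j == i))))
         (cong (_+ ∑ λ j → ι (b j ∧ not (j == i))) (∑-δ i 1)))
  where
  term : ∀ j → ι (b j) ≡ ι (j == i) * 1 + ι (b j ∧ not (j == i))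
  term j with j ≟ i
  ... | yes refl rewrite bi = refl
  ... | no  _    rewrite Bool.∧-identityʳ (b j) = refl

x∈p─q⇒x∉q : ∀ {n} (p q : Subset n) {x} → x ∈ p ─ q → x ∉ q
x∈p─q⇒x∉q (_ ∷ p) (true  ∷ q) (there x∈) (there x∈q) = x∈p─q⇒x∉q p q x∈ x∈q
x∈p─q⇒x∉q (_ ∷ p) (false ∷ q) (there x∈) (there x∈q) = x∈p─q⇒x∉q p q x∈ x∈q

∉⇒lookup : ∀ {n} {p : Subset n} {i} → i ∉ p → lookup p i ≡ false
∉⇒lookup {p = p} {i} i∉p = Bool.¬-not (i∉p ∘ lookup⇒[]= i p)

lookup⇒∉ : ∀ {n} {p : Subset n} {i} → lookup p i ≡ false → i ∉ p
lookup⇒∉ eq i∈p = true≢false (trans (sym ([]=⇒lookup i∈p)) eq)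

-- Reachability in a finite relation.

module Reachability {n} (R : Fin n → Fin n → Set) (R? : ∀ a b → Dec (R a b)) where

  Closed : Subset n → Set
  Closed X = ∀ {a b} → a ∈ X → R a b → b ∈ X

  closed-Star : ∀ {X} → Closed X → ∀ {a b} → a ∈ X → Star R a b → b ∈ X
  closed-Star cl a∈X ε        = a∈X
  closed-Star cl a∈X (r ◅ rs) = closed-Star cl (cl a∈X r) rs

  opaque
    grow : ∀ u X → Acc _⊃_ X → u ∈ X → (∀ {a} → a ∈ X → Star R u a) →
           Σ[ Y ∈ Subset n ] (u ∈ Y × (∀ {a} → a ∈ Y → Star R u a) × Closed Y)
    grow u X (acc rec) u∈X reach
      with any? (λ a → any? (λ b → (a ∈? X) ×-dec R? a b ×-dec ¬? (b ∈? X)))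
    ... | yes (a , b , a∈X , r , b∉X) =
      grow u (X ∪ ⁅ b ⁆) (rec (p⊆p∪q ⁅ b ⁆ , b , q⊆p∪q X ⁅ b ⁆ (x∈⁅x⁆ b) , b∉X))
        (p⊆p∪q ⁅ b ⁆ u∈X) reach′
      where
      reach′ : ∀ {c} → c ∈ X ∪ ⁅ b ⁆ → Star R u c
      reach′ c∈ with x∈p∪q⁻ X ⁅ b ⁆ c∈
      ... | inj₁ c∈X = reach c∈X
      ... | inj₂ c∈b rewrite x∈⁅y⁆⇒x≡y b c∈b = reach a∈X ◅◅ (r ◅ ε)
    ... | no ¬∃ = X , u∈X , reach , closed
      where
      closed : Closed X
      closed {a} {b} a∈X r with b ∈? X
      ... | yes b∈X = b∈X
      ... | no  b∉X = contradiction (a , b , a∈X , r , b∉X) ¬∃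

    reachable : ∀ u → Σ[ Y ∈ Subset n ] (u ∈ Y × (∀ {a} → a ∈ Y → Star R u a) × Closed Y)
    reachable u = grow u ⁅ u ⁆ (⊃-wellFounded _) (x∈⁅x⁆ u)
      λ a∈u → subst (Star R u) (sym (x∈⁅y⁆⇒x≡y u a∈u)) ε

  reachable? : ∀ u v → Dec (Star R u v)
  reachable? u v with reachable u
  ... | Y , u∈Y , reach , closed with v ∈? Y
  ...   | yes v∈Y = yes (reach v∈Y)
  ...   | no  v∉Y = no λ rs → v∉Y (closed-Star closed u∈Y rs)

  -- A failing path is replaced by a witness that can be counted: the set of vertices reachable from
  -- `u`, which no arc leaves.
  reach-or-cut : ∀ u v → Star R u v ⊎
    Σ[ X ∈ (Fin n → Bool) ] (X u ≡ true × X v ≡ false ×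
      (∀ {a b} → R a b → X a ≡ true → X b ≡ true))
  reach-or-cut u v with reachable u
  ... | Y , u∈Y , reach , closed with lookup Y v in eq
  ...   | true  = inj₁ (reach (lookup⇒[]= v Y eq))
  ...   | false = inj₂ (lookup Y , []=⇒lookup u∈Y , eq ,
            λ {a} {b} r a∈ → []=⇒lookup (closed (lookup⇒[]= a Y a∈) r))

∃Bool? : {P : Bool → Set} → (∀ b → Dec (P b)) → Dec (∃[ b ] P b)
∃Bool? P? with P? false | P? true
... | yes p | _     = yes (false , p)
... | no  _ | yes p = yes (true , p)
... | no ¬p | no ¬q = no λ { (false , p) → ¬p p ; (true , q) → ¬q q }

-- Degrees and double counting.

module Counting (G : Graph) where
  open Graph G

  -- One function for all degree counts: an orientation `o` gives outdegrees, `not ∘ o` gives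
  -- indegrees, and the two constant orientations give the two halves of the undirected degree.
  at : (Edge → Bool) → Orientation → Vertex → ℕ
  at h o w = ∑ λ e → ι (h e) * ι (end e (o e) == w)

  deg : (Edge → Bool) → Vertex → ℕ
  deg h w = at h (const false) w + at h (const true) w

  ∣∩fibre∣ : ∀ H o w → ∣ H ∩ fibre (tail o) w ∣ ≡ at (lookup H) o w
  ∣∩fibre∣ H o w = trans (card (H ∩ fibre (tail o) w)) (∑-cong λ e →
    trans (cong ι (trans (lookup-zipWith _∧_ e H _)
                         (cong (lookup H e ∧_) (lookup∘tabulate _ e))))
          (ι-∧ (lookup H e) _))

  degree≡deg : ∀ H w → degree H w ≡ deg (lookup H) w
  degree≡deg H w = cong₂ _+_ (∣∩fibre∣ H (const false) w) (∣∩fibre∣ H (const true) w)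

  both-ends : (g : Bool → ℕ) (b : Bool) → g false + g true ≡ g b + g (not b)
  both-ends g false = refl
  both-ends g true  = +-comm (g false) (g true)

  deg-split : ∀ h o w → deg h w ≡ at h o w + at h (not ∘ o) w
  deg-split h o w = ∑-balance λ e → both-ends (λ b → ι (h e) * ι (end e b == w)) (o e)

  -- Exchange of summation. The vertex weight `W` is kept general because the constant 1 gives the
  -- handshake identity and an indicator gives counts of edges at a vertex set.
  weighted : ∀ h o (W : Vertex → ℕ) →
             ∑ (λ w → W w * at h o w) ≡ ∑ (λ e → ι (h e) * W (end e (o e)))
  weighted h o W = begin
    ∑ (λ w → W w * at h o w)
      ≡⟨ ∑-cong (λ w → *-∑ (W w) (λ e → ι (h e) * ι (end e (o e) == w))) ⟩
    ∑ (λ w → ∑ λ e → W w * (ι (h e) * ι (end e (o e) == w)))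
      ≡⟨ ∑-swap (λ w e → W w * (ι (h e) * ι (end e (o e) == w))) ⟩
    ∑ (λ e → ∑ λ w → W w * (ι (h e) * ι (end e (o e) == w)))
      ≡⟨ ∑-cong (λ e → trans (∑-support (end e (o e)) (off e)) (on e)) ⟩
    ∑ (λ e → ι (h e) * W (end e (o e))) ∎
    where
    open ≡-Reasoning
    off : ∀ e w → w ≢ end e (o e) → W w * (ι (h e) * ι (end e (o e) == w)) ≡ 0
    off e w w≢ rewrite ≢⇒== (w≢ ∘ sym) | *-zeroʳ (ι (h e)) = *-zeroʳ (W w)
    on : ∀ e → W (end e (o e)) * (ι (h e) * ι (end e (o e) == end e (o e))) ≡
               ι (h e) * W (end e (o e))
    on e rewrite ==-refl (end e (o e)) | *-identityʳ (ι (h e)) = *-comm _ (ι (h e))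

  weighted-deg : ∀ h o (W : Vertex → ℕ) → ∑ (λ w → W w * deg h w) ≡
                 ∑ (λ e → ι (h e) * W (end e (o e)) + ι (h e) * W (end e (not (o e))))
  weighted-deg h o W = begin
    ∑ (λ w → W w * deg h w)
      ≡⟨ ∑-cong (λ w → trans (cong (W w *_) (deg-split h o w))
                                 (*-distribˡ-+ (W w) (at h o w) (at h (not ∘ o) w))) ⟩
    ∑ (λ w → W w * at h o w + W w * at h (not ∘ o) w)
      ≡⟨ ∑-+ _ _ ⟩
    ∑ (λ w → W w * at h o w) + ∑ (λ w → W w * at h (not ∘ o) w)
      ≡⟨ cong₂ _+_ (weighted h o W) (weighted h (not ∘ o) W) ⟩
    ∑ (λ e → ι (h e) * W (end e (o e))) + ∑ (λ e → ι (h e) * W (end e (not (o e))))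
      ≡⟨ ∑-+ _ _ ⟨
    ∑ (λ e → ι (h e) * W (end e (o e)) + ι (h e) * W (end e (not (o e)))) ∎
    where open ≡-Reasoning

  handshake : ∀ h → ∑ (deg h) ≡ ∑ (ι ∘ h) + ∑ (ι ∘ h)
  handshake h = begin
    ∑ (deg h)                          ≡⟨ ∑-cong (λ w → sym (*-identityˡ (deg h w))) ⟩
    ∑ (λ w → 1 * deg h w)              ≡⟨ weighted-deg h (const false) (const 1) ⟩
    ∑ (λ e → ι (h e) * 1 + ι (h e) * 1)
      ≡⟨ ∑-cong (λ e → cong₂ _+_ (*-identityʳ (ι (h e))) (*-identityʳ (ι (h e)))) ⟩
    ∑ (λ e → ι (h e) + ι (h e))        ≡⟨ ∑-+ _ _ ⟩
    ∑ (ι ∘ h) + ∑ (ι ∘ h)            ∎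
    where open ≡-Reasoning

  at-mono : ∀ {h k : Edge → Bool} (o : Orientation) w →
            (∀ e → ι (h e) ≤ ι (k e)) → at h o w ≤ at k o w
  at-mono o w h≤k = ∑-mono λ e → *-monoˡ-≤ _ (h≤k e)

  at-cong : ∀ {h k : Edge → Bool} (o : Orientation) w →
            (∀ e → end e (o e) ≡ w → h e ≡ k e) → at h o w ≡ at k o w
  at-cong {h} {k} o w h≡k = ∑-cong term
    where
    term : ∀ e → ι (h e) * ι (end e (o e) == w) ≡ ι (k e) * ι (end e (o e) == w)
    term e with end e (o e) ≟ w
    ... | yes eq = cong (λ b → ι b * 1) (h≡k e eq)
    ... | no  _  = trans (*-zeroʳ (ι (h e))) (sym (*-zeroʳ (ι (k e))))

  deg-cong : ∀ {h k : Edge → Bool} w → (∀ e b → end e b ≡ w → h e ≡ k e) → deg h w ≡ deg k w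
  deg-cong w h≡k = cong₂ _+_ (at-cong (const false) w λ e → h≡k e false)
                             (at-cong (const true)  w λ e → h≡k e true)

  deg-zero : ∀ {h : Edge → Bool} {w} → (∀ e b → end e b ≡ w → h e ≡ false) → deg h w ≡ 0
  deg-zero {h} {w} h≡ = trans (deg-cong w h≡) (cong₂ _+_ (none (const false)) (none (const true)))
    where
    none : ∀ o → at (const false) o w ≡ 0
    none o = ∑-zero λ _ → refl

  at-term : ∀ (h : Edge → Bool) (o : Orientation) e → h e ≡ true →
            ι (h e) * ι (end e (o e) == end e (o e)) ≡ 1
  at-term h o e he rewrite he | ==-refl (end e (o e)) = refl

  1≤at : ∀ h (o : Orientation) e → h e ≡ true → 1 ≤ at h o (end e (o e))
  1≤at h o e he = ≤-trans (≤-reflexive (sym (at-term h o e he))) (term≤∑ _ e)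

  1≤deg : ∀ h e b → h e ≡ true → 1 ≤ deg h (end e b)
  1≤deg h e b he rewrite deg-split h (const b) (end e b) =
    ≤-trans (1≤at h (const b) e he) (m≤m+n _ _)

  2≤at : ∀ h o {e f} w → e ≢ f → h e ≡ true → h f ≡ true →
         end e (o e) ≡ w → end f (o f) ≡ w → 2 ≤ at h o w
  2≤at h o {e} {f} w e≢f he hf refl ef = ≤-trans
    (≤-reflexive (sym (cong₂ _+_ (at-term h o e he)
      (subst (λ v → ι (h f) * ι (end f (o f) == v) ≡ 1) ef (at-term h o f hf)))))
    (two-terms≤∑ (λ g → ι (h g) * ι (end g (o g) == w)) e≢f)

  deg≡0 : ∀ h w → deg h w ≡ 0 → ∀ e b → end e b ≡ w → h e ≡ false
  deg≡0 h w d≡0 e b refl with h e in he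
  ... | false = refl
  ... | true  = contradiction (≤-trans (1≤deg h e b he) (≤-reflexive d≡0)) λ ()

  -- Splitting the degree into its two halves, neither half of `h` exceeds that of `k`, so equal
  -- totals force equal halves, and then equal terms.
  deg-saturated : ∀ {h k : Edge → Bool} w → (∀ e → ι (h e) ≤ ι (k e)) → deg h w ≡ deg k w →
                  ∀ e b → end e b ≡ w → k e ≡ true → h e ≡ true
  deg-saturated {h} {k} w h≤k dh≡dk e b refl ke =
    step (h e) (∑-squeeze (λ f → *-monoˡ-≤ _ (h≤k f)) k≤h e)
    where
    k≤h : at k (const b) w ≤ at h (const b) w
    k≤h = +-cancelʳ-≤ (at h (const (not b)) w) _ _ (≤-trans
      (+-monoʳ-≤ (at k (const b) w) (at-mono (const (not b)) w h≤k))
      (≤-reflexive (trans (sym (deg-split k (const b) w))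
        (trans (sym dh≡dk) (deg-split h (const b) w)))))
    step : ∀ c → ι c * ι (end e b == w) ≡ ι (k e) * ι (end e b == w) → c ≡ true
    step true  _  = refl
    step false eq = contradiction (trans eq (at-term k (const b) e ke)) λ ()

-- Components, circuits and smoothness as flow conservation.

module Components (G : Graph) where
  open Graph G
  open Counting G

  Incident : Edge → Vertex → Set
  Incident e w = ∃[ b ] end e b ≡ w

  ∈fibre⁻ : ∀ b {e w} → e ∈ fibre (λ f → end f b) w → end e b ≡ w
  ∈fibre⁻ b {e} {w} e∈ = ==⇒≡ _ _ (trans (sym (lookup∘tabulate _ e)) ([]=⇒lookup e∈))

  ∈fibre⁺ : ∀ b {e w} → end e b ≡ w → e ∈ fibre (λ f → end f b) w
  ∈fibre⁺ b {e} refl = lookup⇒[]= e _ (trans (lookup∘tabulate _ e) (==-refl (end e b)))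

  ∈incident⁻ : ∀ {e w} → e ∈ incidentEdges w → Incident e w
  ∈incident⁻ {e} {w} e∈ with x∈p∪q⁻ _ _ e∈
  ... | inj₁ e∈f = false , ∈fibre⁻ false e∈f
  ... | inj₂ e∈t = true  , ∈fibre⁻ true  e∈t

  ∈incident⁺ : ∀ {e w} → Incident e w → e ∈ incidentEdges w
  ∈incident⁺ (false , eq) = x∈p∪q⁺ (inj₁ (∈fibre⁺ false eq))
  ∈incident⁺ (true  , eq) = x∈p∪q⁺ (inj₂ (∈fibre⁺ true eq))

  ∈V⁻ : ∀ {w H} → w ∈V H → ∃[ e ] (e ∈ H × Incident e w)
  ∈V⁻ {w} {H} (e , e∈) with x∈p∩q⁻ H (incidentEdges w) e∈
  ... | e∈H , e∈w = e , e∈H , ∈incident⁻ e∈w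

  ∈V⁺ : ∀ {w H e} → e ∈ H → Incident e w → w ∈V H
  ∈V⁺ e∈H inc = _ , x∈p∩q⁺ (e∈H , ∈incident⁺ inc)

  adjacent : ∀ {H e} → e ∈ H → ∀ b → Adjacent H (end e b) (end e (not b))
  adjacent e∈H b = _ , e∈H , b , refl , refl

  adjacent-sym : ∀ {H u v} → Adjacent H u v → Adjacent H v u
  adjacent-sym (e , e∈H , b , eu , ev) =
    e , e∈H , not b , ev , trans (cong (end e) (Bool.not-involutive b)) eu

  connected-sym : ∀ {H u v} → Connected H u v → Connected H v u
  connected-sym = reverse adjacent-sym

  connected-mono : ∀ {H K u v} → H ⊆ K → Connected H u v → Connected K u v
  connected-mono H⊆K = gmap (λ v → v) λ { (e , e∈H , j) → e , H⊆K e∈H , j }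

  adjacent? : ∀ H u v → Dec (Adjacent H u v)
  adjacent? H u v = any? λ e → (e ∈? H) ×-dec
    ∃Bool? (λ b → (end e b ≟ u) ×-dec (end e (not b) ≟ v))

  arc? : ∀ o H u v → Dec (Arc o H u v)
  arc? o H u v = any? λ e → (e ∈? H) ×-dec ((tail o e ≟ u) ×-dec (head o e ≟ v))

  module Conn (H : EdgeSet) = Reachability (Adjacent H) (adjacent? H)

  opaque
    connected? : ∀ H u v → Dec (Connected H u v)
    connected? H = Conn.reachable? H

  opaque
    -- Testing the `false` end suffices, since an edge of `H` connects its own two ends.
    component : EdgeSet → Vertex → EdgeSet
    component H v = tabulate λ e → lookup H e ∧ does (connected? H v (end e false))

    lookup-component : ∀ H v {w} → Connected H v w → ∀ e b → end e b ≡ w →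
                       lookup (component H v) e ≡ lookup H e
    lookup-component H v v~w e b refl
      rewrite lookup∘tabulate (λ f → lookup H f ∧ does (connected? H v (end f false))) e
      with lookup H e in he
    ... | false = refl
    ... | true  = dec-true (connected? H v (end e false)) (first-end b v~w)
      where
      first-end : ∀ b → Connected H v (end e b) → Connected H v (end e false)
      first-end false c = c
      first-end true  c = c ◅◅ (adjacent (lookup⇒[]= e H he) true ◅ ε)

    component⁻ : ∀ H v {e} → e ∈ component H v → e ∈ H × ∀ b → Connected H v (end e b)
    component⁻ H v {e} e∈ with lookup H e in he
                             | connected? H v (end e false) in ce
                             | trans (sym (lookup∘tabulate (λ f → lookup H f ∧ does (connected? H v (end f false))) e)) ([]=⇒lookup e∈)
    ... | false | _     | eq = contradiction (sym eq) true≢false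
    ... | true  | no _  | eq = contradiction (sym eq) true≢false
    ... | true  | yes c | _  = lookup⇒[]= e H he , λ
      { false → c ; true → c ◅◅ (adjacent (lookup⇒[]= e H he) false ◅ ε) }

  component⊆ : ∀ H v → component H v ⊆ H
  component⊆ H v e∈ = proj₁ (component⁻ H v e∈)

  ∈component : ∀ H v {e b} → e ∈ H → Connected H v (end e b) → e ∈ component H v
  ∈component H v {e} {b} e∈H c =
    lookup⇒[]= e _ (trans (lookup-component H v c e b refl) ([]=⇒lookup e∈H))

  at-component : ∀ H v {w} → Connected H v w → ∀ o →
                 at (lookup (component H v)) o w ≡ at (lookup H) o w
  at-component H v {w} c o = at-cong o w λ e → lookup-component H v c e (o e)

  deg-component : ∀ H v {w} → Connected H v w →
                  deg (lookup (component H v)) w ≡ deg (lookup H) w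
  deg-component H v c = cong₂ _+_ (at-component H v c (const false)) (at-component H v c (const true))

  ∈V-component : ∀ H v {w} → w ∈V component H v → Connected H v w
  ∈V-component H v w∈ with ∈V⁻ {H = component H v} w∈
  ... | e , e∈K , b , refl = proj₂ (component⁻ H v e∈K) b

  connected-component : ∀ H v {w} → Connected H v w → Connected (component H v) v w
  connected-component H v = go ε
    where
    go : ∀ {u w} → Connected H v u → Connected H u w → Connected (component H v) u w
    go v~u ε = ε
    go v~u (a@(e , e∈H , b , refl , eq) ◅ u~w) =
      (e , ∈component H v e∈H v~u , b , refl , eq) ◅ go (v~u ◅◅ (a ◅ ε)) u~w

  -- All edges of `H` at a vertex of the component belong to the component, so degrees agree with
  -- those in `H`; degree 0 is impossible where an edge of the component ends.
  component-isCircuit : ∀ H → (∀ w → deg (lookup H) w ≡ 0 ⊎ deg (lookup H) w ≡ 2) →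
                        ∀ {v} → v ∈V H → IsCircuit (component H v)
  component-isCircuit H deg02 {v} v∈ = record
    { nonempty  = nonempty
    ; regular   = regular
    ; connected = λ u w u∈ w∈ →
        connected-sym (connected-component H v (∈V-component H v u∈)) ◅◅
        connected-component H v (∈V-component H v w∈)
    }
    where
    nonempty : Nonempty (component H v)
    nonempty with ∈V⁻ {H = H} v∈
    ... | e , e∈H , b , refl = e , ∈component H v e∈H ε
    regular : ∀ w → w ∈V component H v → degree (component H v) w ≡ 2
    regular w w∈ with deg02 w
    ... | inj₂ d≡2 = trans (degree≡deg (component H v) w)
                       (trans (deg-component H v (∈V-component H v w∈)) d≡2)
    ... | inj₁ d≡0 with ∈V⁻ {H = component H v} w∈
    ...   | e , e∈K , b , eq = contradiction
      (trans (sym ([]=⇒lookup (component⊆ H v e∈K))) (deg≡0 (lookup H) w d≡0 e b eq)) true≢false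

  Balanced : (Edge → Bool) → Orientation → Set
  Balanced h o = ∀ w → at h o w ≡ at h (not ∘ o) w

  -- Conservation tested against a potential `W`. For the indicator of a vertex set it says that as
  -- much flow enters the set as leaves it.
  balanced-∑ : ∀ h o → Balanced h o → ∀ (W : Vertex → ℕ) →
    ∑ (λ e → ι (h e) * W (tail o e)) ≡ ∑ (λ e → ι (h e) * W (head o e))
  balanced-∑ h o bal W = trans (sym (weighted h o W))
    (trans (∑-cong λ w → cong (W w *_) (bal w)) (weighted h (not ∘ o) W))

  1≤deg⇒∈V : ∀ H w → 1 ≤ deg (lookup H) w → w ∈V H
  1≤deg⇒∈V H w 1≤d with any? (λ e → (e ∈? H) ×-dec ∃Bool? (λ b → end e b ≟ w))
  ... | yes (e , e∈H , inc) = ∈V⁺ e∈H inc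
  ... | no ¬∃ = contradiction (≤-trans 1≤d (≤-reflexive (deg-zero λ e b eq →
    Bool.¬-not λ he → ¬∃ (e , lookup⇒[]= e H he , b , eq)))) λ ()

  deg-2⇒∈V : ∀ H w → deg (lookup H) w ≡ 2 → w ∈V H
  deg-2⇒∈V H w d≡2 = 1≤deg⇒∈V H w (≤-trans (s≤s z≤n) (≤-reflexive (sym d≡2)))

  -- Smoothness speaks only of circuits. The component at `w` is a circuit that contains every edge
  -- of `H` at `w`, so its in- and outdegree there are those of `H`.
  smooth-at : ∀ H o → IsSmooth H o → (∀ w → deg (lookup H) w ≡ 0 ⊎ deg (lookup H) w ≡ 2) →
              ∀ w → deg (lookup H) w ≡ 2 →
              at (lookup H) (not ∘ o) w ≡ 1 × at (lookup H) o w ≡ 1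
  smooth-at H o smooth deg02 w d≡2
    with smooth (component H w) (component-isCircuit H deg02 w∈ , component⊆ H w) w w∈K
    where
    w∈ : w ∈V H
    w∈ = deg-2⇒∈V H w d≡2
    w∈K : w ∈V component H w
    w∈K = deg-2⇒∈V (component H w) w (trans (deg-component H w ε) d≡2)
  ... | in≡1 , out≡1 =
    trans (sym (trans (∣∩fibre∣ (component H w) (not ∘ o) w) (at-component H w ε (not ∘ o)))) in≡1 ,
    trans (sym (trans (∣∩fibre∣ (component H w) o w) (at-component H w ε o))) out≡1

  smooth⇒balanced : ∀ H o → IsSmooth H o →
    (∀ w → deg (lookup H) w ≡ 0 ⊎ deg (lookup H) w ≡ 2) → Balanced (lookup H) o
  smooth⇒balanced H o smooth deg02 w with deg02 w
  ... | inj₂ d≡2 with smooth-at H o smooth deg02 w d≡2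
  ...   | in≡1 , out≡1 = trans out≡1 (sym in≡1)
  smooth⇒balanced H o smooth deg02 w | inj₁ d≡0 =
    trans (m+n≡0⇒m≡0 _ split≡0) (sym (m+n≡0⇒n≡0 (at (lookup H) o w) split≡0))
    where
    split≡0 : at (lookup H) o w + at (lookup H) (not ∘ o) w ≡ 0
    split≡0 = trans (sym (deg-split (lookup H) o w)) d≡0

-- Small cuts in a cyclically 4-edge-connected cubic graph.

module Cuts (G : Graph) where
  open Graph G
  open Counting G
  open Components G

  Within : (Edge → Bool) → (Vertex → Bool) → Set
  Within h Y = ∀ e b → h e ≡ true → Y (end e b) ≡ true

  TwoRegularPart : (Edge → Bool) → Set
  TwoRegularPart h = Σ[ k ∈ (Edge → Bool) ]
    ((∀ e → k e ≡ true → h e ≡ true) × (∃[ e ] k e ≡ true) ×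
     (∀ w → deg k w ≡ 0 ⊎ deg k w ≡ 2))

  -- Vertices of degree at most 1 are pruned and superfluous edges dropped; neither
  -- destroys ∣Y∣ ≤ ∣h∣, and when neither is possible the degree sum forces 2-regularity.
  dense⇒twoRegular : ∀ n h Y → ∑ (ι ∘ Y) + ∑ (ι ∘ h) ≤ n → Within h Y →
                     1 ≤ ∑ (ι ∘ Y) → ∑ (ι ∘ Y) ≤ ∑ (ι ∘ h) → TwoRegularPart h
  dense⇒twoRegular zero h Y small within 1≤Y Y≤h =
    contradiction (≤-trans 1≤Y (≤-trans (m≤m+n _ _) small)) λ ()
  dense⇒twoRegular (suc n) h Y small within 1≤Y Y≤h
    with ∑-witness h (≤-trans 1≤Y Y≤h)
       | any? (λ w → (Y w Bool.≟ true) ×-dec (deg h w ≤? 1))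
  ... | e₀ , he₀ | yes (w , Yw , d≤1) = prune (dense⇒twoRegular n h′ Y′ small′ within′ 1≤Y′ Y′≤h′)
    where
    Y′ : Vertex → Bool
    Y′ v = Y v ∧ not (v == w)
    h′ : Edge → Bool
    h′ e = h e ∧ (not (end e false == w) ∧ not (end e true == w))
    Y-count : ∑ (ι ∘ Y) ≡ suc (∑ (ι ∘ Y′))
    Y-count = ∑-remove Y Yw
    term : ∀ a b c → ι a ≤ ι (a ∧ (not b ∧ not c)) + (ι a * ι b + ι a * ι c)
    term false _     _     = z≤n
    term true  true  _     = s≤s z≤n
    term true  false true  = s≤s z≤n
    term true  false false = s≤s z≤n
    h-count : ∑ (ι ∘ h) ≤ suc (∑ (ι ∘ h′))
    h-count = begin
      ∑ (ι ∘ h) ≤⟨ ∑-mono (λ e → term (h e) (end e false == w) (end e true == w)) ⟩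
      ∑ (λ e → ι (h′ e) + (ι (h e) * ι (end e false == w) + ι (h e) * ι (end e true == w)))
        ≡⟨ trans (∑-+ (ι ∘ h′) _) (cong (∑ (ι ∘ h′) +_) (∑-+ (λ e → ι (h e) * ι (end e false == w)) _)) ⟩
      ∑ (ι ∘ h′) + deg h w ≤⟨ +-monoʳ-≤ (∑ (ι ∘ h′)) d≤1 ⟩
      ∑ (ι ∘ h′) + 1       ≡⟨ +-comm _ 1 ⟩
      suc (∑ (ι ∘ h′))     ∎
      where open ≤-Reasoning
    Y′≤h′ : ∑ (ι ∘ Y′) ≤ ∑ (ι ∘ h′)
    Y′≤h′ = s≤s⁻¹ (≤-trans (≤-reflexive (sym Y-count)) (≤-trans Y≤h h-count))
    small′ : ∑ (ι ∘ Y′) + ∑ (ι ∘ h′) ≤ n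
    small′ = s≤s⁻¹ (≤-trans (+-mono-≤ (≤-reflexive (sym Y-count))
      (∑-mono λ e → h′≤h (h e) _)) small)
      where
      h′≤h : ∀ a c → ι (a ∧ c) ≤ ι a
      h′≤h true  c = ι≤1 c
      h′≤h false c = z≤n
    within′ : Within h′ Y′
    within′ e b h′e with ∧-true {h e} h′e
    ... | he , ne with ∧-true {not (end e false == w)} ne | b
    ...   | nf , nt | false = cong₂ _∧_ (within e false he) nf
    ...   | nf , nt | true  = cong₂ _∧_ (within e true he) nt
    1≤Y′-at : ∀ b → end e₀ b ≢ w → 1 ≤ ∑ (ι ∘ Y′)
    1≤Y′-at b ≢w = ≤-trans
      (≤-reflexive (sym (cong ι (cong₂ _∧_ (within e₀ b he₀) (cong not (≢⇒== ≢w))))))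
      (term≤∑ (ι ∘ Y′) (end e₀ b))
    -- A loop at `w` would count twice in its degree, so `e₀` has an end other than `w`, and that
    -- end survives the pruning.
    1≤Y′ : 1 ≤ ∑ (ι ∘ Y′)
    1≤Y′ with end e₀ false ≟ w | end e₀ true ≟ w
    ... | no ≢w | _     = 1≤Y′-at false ≢w
    ... | yes _ | no ≢w = 1≤Y′-at true ≢w
    ... | yes p | yes q = contradiction
      (≤-trans (+-mono-≤ (subst (λ v → 1 ≤ at h (const false) v) p (1≤at h (const false) e₀ he₀))
                         (subst (λ v → 1 ≤ at h (const true) v) q (1≤at h (const true) e₀ he₀)))
               d≤1)
      λ { (s≤s ()) }
    prune : TwoRegularPart h′ → TwoRegularPart h
    prune (k , k⊆h′ , rest) = k , (λ e ke → proj₁ (∧-true {h e} (k⊆h′ e ke))) , rest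
  ... | e₀ , he₀ | no ¬∃ with ∑ (ι ∘ h) ≤? ∑ (ι ∘ Y)
  ...   | yes h≤Y = h , (λ _ he → he) , (e₀ , he₀) , λ w → regular w (Y w) (deg≡ w)
    where
    2Y≤deg : ∀ w → ι (Y w) + ι (Y w) ≤ deg h w
    2Y≤deg w with Y w in Yw
    ... | false = z≤n
    ... | true  = ≰⇒> λ d≤1 → ¬∃ (w , Yw , d≤1)
    deg≡ : ∀ w → ι (Y w) + ι (Y w) ≡ deg h w
    deg≡ = ∑-squeeze 2Y≤deg (≤-trans (≤-reflexive (handshake h))
      (≤-trans (+-mono-≤ h≤Y h≤Y) (≤-reflexive (sym (∑-+ (ι ∘ Y) (ι ∘ Y))))))
    regular : ∀ w c → ι c + ι c ≡ deg h w → deg h w ≡ 0 ⊎ deg h w ≡ 2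
    regular w false eq = inj₁ (sym eq)
    regular w true  eq = inj₂ (sym eq)
  ...   | no h≰Y = drop (dense⇒twoRegular n h′ Y small′ (λ e b h′e → within e b (proj₁ (∧-true {h e} h′e)))
                           1≤Y (s≤s⁻¹ (≤-trans (≰⇒> h≰Y) (≤-reflexive h-count))))
    where
    h′ : Edge → Bool
    h′ e = h e ∧ not (e == e₀)
    h-count : ∑ (ι ∘ h) ≡ suc (∑ (ι ∘ h′))
    h-count = ∑-remove h he₀
    small′ : ∑ (ι ∘ Y) + ∑ (ι ∘ h′) ≤ n
    small′ = s≤s⁻¹ (≤-trans (≤-reflexive (trans (sym (+-suc _ _))
      (cong (∑ (ι ∘ Y) +_) (sym h-count)))) small)
    drop : TwoRegularPart h′ → TwoRegularPart h
    drop (k , k⊆h′ , rest) = k , (λ e ke → proj₁ (∧-true {h e} (k⊆h′ e ke))) , rest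

  component-isCycle : ∀ H v → (∀ w → deg (lookup H) w ≡ 0 ⊎ deg (lookup H) w ≡ 2) →
                      IsCycle (component H v)
  component-isCycle H v deg02 w rewrite degree≡deg (component H v) w with connected? H v w
  ... | yes c rewrite deg-component H v c with deg02 w
  ...   | inj₁ d≡0 rewrite d≡0 = 2 ∣0
  ...   | inj₂ d≡2 rewrite d≡2 = ∣-refl
  component-isCycle H v deg02 w | no ¬c =
    subst (2 ∣_) (sym (deg-zero outside)) (2 ∣0)
    where
    outside : ∀ e b → end e b ≡ w → lookup (component H v) e ≡ false
    outside e b refl = Bool.¬-not λ e∈ →
      ¬c (proj₂ (component⁻ H v (lookup⇒[]= e _ e∈)) b)

  -- At least as many inner edges as vertices force a 2-regular part inside `Y`; its component at an
  -- end of one of its edges is the required cycle.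
  side-cycle : ∀ (Y : Vertex → Bool) S →
    (∀ e → Y (end e false) ∧ Y (end e true) ≡ true → e ∈ ∁ S) →
    1 ≤ ∑ (ι ∘ Y) → ∑ (ι ∘ Y) ≤ ∑ (λ e → ι (Y (end e false) ∧ Y (end e true))) →
    ∃[ v ] (Y v ≡ true × ComponentHasCycle (∁ S) v)
  side-cycle Y S h⊆∁S 1≤Y Y≤h
    with dense⇒twoRegular _ (λ e → Y (end e false) ∧ Y (end e true)) Y ≤-refl within 1≤Y Y≤h
    where
    within : Within (λ e → Y (end e false) ∧ Y (end e true)) Y
    within e false he = proj₁ (∧-true he)
    within e true  he = proj₂ (∧-true he)
  ... | k , k⊆h , (e , ke) , deg02 =
    v , proj₁ (∧-true (k⊆h e ke)) , component K v , component-isCycle K v deg02′ ,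
    (e , ∈component K v {b = false} e∈K ε) , (λ f∈ → K⊆ (component⊆ K v f∈)) ,
    λ u u∈ → connected-mono K⊆ (∈V-component K v u∈)
    where
    K : EdgeSet
    K = tabulate k
    v : Vertex
    v = end e false
    e∈K : e ∈ K
    e∈K = lookup⇒[]= e K (trans (lookup∘tabulate k e) ke)
    K⊆ : K ⊆ ∁ S
    K⊆ {f} f∈ = h⊆∁S f (k⊆h f (trans (sym (lookup∘tabulate k f)) ([]=⇒lookup f∈)))
    deg02′ : ∀ w → deg (lookup K) w ≡ 0 ⊎ deg (lookup K) w ≡ 2
    deg02′ w rewrite deg-cong {lookup K} {k} w (λ f _ _ → lookup∘tabulate k f) = deg02 w

  crosses : (Vertex → Bool) → Edge → Bool
  crosses X e = X (end e false) xor X (end e true)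

  deg≡3 : Cubic → ∀ w → deg (const true) w ≡ 3
  deg≡3 cubic w = trans (deg-cong w λ e _ _ → sym (lookup-replicate e true))
                        (trans (sym (degree≡deg ⊤ w)) (cubic w))

  -- The degree sum over `Y` meets an inner edge at both ends and a crossing edge at one.
  cubic-count : Cubic → ∀ (Y : Vertex → Bool) →
    ∑ (ι ∘ Y) * 3 ≡ (∑ (λ e → ι (Y (end e false) ∧ Y (end e true))) +
                     ∑ (λ e → ι (Y (end e false) ∧ Y (end e true)))) + ∑ (ι ∘ crosses Y)
  cubic-count cubic Y = begin
    ∑ (ι ∘ Y) * 3                     ≡⟨ *-comm (∑ (ι ∘ Y)) 3 ⟩
    3 * ∑ (ι ∘ Y)                     ≡⟨ *-∑ 3 (ι ∘ Y) ⟩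
    ∑ (λ w → 3 * ι (Y w))
      ≡⟨ ∑-cong (λ w → trans (*-comm 3 (ι (Y w))) (cong (ι (Y w) *_) (sym (deg≡3 cubic w)))) ⟩
    ∑ (λ w → ι (Y w) * deg (const true) w)  ≡⟨ weighted-deg (const true) (const false) (ι ∘ Y) ⟩
    ∑ (λ e → 1 * ι (Y (end e false)) + 1 * ι (Y (end e true)))
      ≡⟨ ∑-cong (λ e → ends (Y (end e false)) (Y (end e true))) ⟩
    ∑ (λ e → (inside e + inside e) + ι (crosses Y e))
      ≡⟨ trans (∑-+ (λ e → inside e + inside e) (ι ∘ crosses Y))
               (cong (_+ ∑ (ι ∘ crosses Y)) (∑-+ inside inside)) ⟩
    (∑ inside + ∑ inside) + ∑ (ι ∘ crosses Y) ∎
    where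
    open ≡-Reasoning
    inside : Edge → ℕ
    inside e = ι (Y (end e false) ∧ Y (end e true))
    ends : ∀ a b → 1 * ι a + 1 * ι b ≡ (ι (a ∧ b) + ι (a ∧ b)) + ι (a xor b)
    ends true  true  = refl
    ends true  false = refl
    ends false true  = refl
    ends false false = refl

  -- Here `n` counts the vertices of a side, `m` its inner edges and `d` the cut. From m ≤ n - 1 and
  -- 3n = 2m + d follows d ≥ n + 2.
  small-acyclic-side : ∀ n m d → n * 3 ≡ (m + m) + d → d ≤ 3 → 1 ≤ n → m < n → n ≡ 1 × d ≡ 3
  small-acyclic-side n m d count d≤3 1≤n m<n = n≡1 , d≡3
    where
    n+2≤d : n + 2 ≤ d
    n+2≤d = +-cancelˡ-≤ (m + m) _ _ (begin
      (m + m) + (n + 2)       ≡⟨ eq₁ m n ⟩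
      n + (suc m + suc m)     ≤⟨ +-monoʳ-≤ n (+-mono-≤ m<n m<n) ⟩
      n + (n + n)             ≡⟨ eq₂ n ⟩
      n * 3                   ≡⟨ count ⟩
      (m + m) + d             ∎)
      where
      open ≤-Reasoning
      eq₁ : ∀ m n → (m + m) + (n + 2) ≡ n + (suc m + suc m)
      eq₁ = solve-∀
      eq₂ : ∀ n → n + (n + n) ≡ n * 3
      eq₂ = solve-∀
    n≡1 : n ≡ 1
    n≡1 = ≤-antisym (+-cancelʳ-≤ 2 n 1 (≤-trans n+2≤d d≤3)) 1≤n
    d≡3 : d ≡ 3
    d≡3 = ≤-antisym d≤3 (≤-trans (+-monoˡ-≤ 2 1≤n) n+2≤d)

  crosses-not : ∀ X → ∑ (ι ∘ crosses X) ≡ ∑ (ι ∘ crosses (not ∘ X))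
  crosses-not X = ∑-cong λ e → cong ι (xor-not (X (end e false)) (X (end e true)))
    where
    xor-not : ∀ a b → a xor b ≡ not a xor not b
    xor-not true  b = refl
    xor-not false b = sym (Bool.not-involutive b)

  -- A side with fewer inner edges than vertices is a single vertex by counting. If neither side is
  -- of this kind, both contain cycles and at most three edges separate them. In particular no
  -- proper cut has fewer than three edges.
  small-cut : CyclicallyEdgeConnected 4 → Cubic → ∀ (X : Vertex → Bool) {u v} →
    X u ≡ true → X v ≡ false → ∑ (ι ∘ crosses X) ≤ 3 →
    ∑ (ι ∘ crosses X) ≡ 3 × (∑ (ι ∘ X) ≡ 1 ⊎ ∑ (ι ∘ not ∘ X) ≡ 1)
  small-cut cec cubic X {u} {v} Xu Xv d≤3
    with inX <? ∑ (ι ∘ X) | outX <? ∑ (ι ∘ not ∘ X)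
    where
    inX outX : ℕ
    inX  = ∑ λ e → ι (X (end e false) ∧ X (end e true))
    outX = ∑ λ e → ι (not (X (end e false)) ∧ not (X (end e true)))
  ... | yes in< | _ with small-acyclic-side _ _ _ (cubic-count cubic X) d≤3
                           (≤-trans (≤-reflexive (sym (cong ι Xu))) (term≤∑ (ι ∘ X) u)) in<
  ...   | n≡1 , d≡3 = d≡3 , inj₁ n≡1
  small-cut cec cubic X {u} {v} Xu Xv d≤3 | no _ | yes out<
    with small-acyclic-side _ _ _ (cubic-count cubic (not ∘ X))
           (≤-trans (≤-reflexive (sym (crosses-not X))) d≤3)
           (≤-trans (≤-reflexive (sym (cong (ι ∘ not) Xv))) (term≤∑ (ι ∘ not ∘ X) v)) out<
  ... | n≡1 , d≡3 = trans (crosses-not X) d≡3 , inj₂ n≡1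
  small-cut cec cubic X {u} {v} Xu Xv d≤3 | no in≮ | no out≮ = contradiction
    (S , proj₁ inner , proj₁ outer , ≤-trans (s≤s (≤-reflexive S-card)) (s≤s d≤3) ,
     (λ c → true≢false (trans (sym (same-side c (proj₁ (proj₂ inner))))
                              (not-true (proj₁ (proj₂ outer))))) ,
     proj₂ (proj₂ inner) , proj₂ (proj₂ outer))
    cec
    where
    S : EdgeSet
    S = tabulate (crosses X)
    S-card : ∣ S ∣ ≡ ∑ (ι ∘ crosses X)
    S-card = trans (card S) (∑-cong λ e → cong ι (lookup∘tabulate (crosses X) e))
    not-true : ∀ {b} → not b ≡ true → b ≡ false
    not-true {false} _ = refl
    ∈∁S⁺ : ∀ e → crosses X e ≡ false → e ∈ ∁ S
    ∈∁S⁺ e eq = x∉p⇒x∈∁p λ e∈ →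
      true≢false (trans (sym ([]=⇒lookup e∈)) (trans (lookup∘tabulate (crosses X) e) eq))
    ∈∁S⁻ : ∀ e → e ∈ ∁ S → crosses X e ≡ false
    ∈∁S⁻ e e∈ = Bool.¬-not λ ce →
      x∈∁p⇒x∉p e∈ (lookup⇒[]= e S (trans (lookup∘tabulate (crosses X) e) ce))
    xor-same : ∀ a b → a ∧ b ≡ true → a xor b ≡ false
    xor-same true true _ = refl
    xor-same′ : ∀ a b → not a ∧ not b ≡ true → a xor b ≡ false
    xor-same′ false false _ = refl
    xor-false : ∀ a b → a xor b ≡ false → a ≡ b
    xor-false true  true  _ = refl
    xor-false false false _ = refl
    inner : ∃[ w ] (X w ≡ true × ComponentHasCycle (∁ S) w)
    inner = side-cycle X S (λ e he → ∈∁S⁺ e (xor-same (X (end e false)) _ he))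
      (≤-trans (≤-reflexive (sym (cong ι Xu))) (term≤∑ (ι ∘ X) u)) (≮⇒≥ in≮)
    outer : ∃[ w ] (not (X w) ≡ true × ComponentHasCycle (∁ S) w)
    outer = side-cycle (not ∘ X) S (λ e he → ∈∁S⁺ e (xor-same′ (X (end e false)) _ he))
      (≤-trans (≤-reflexive (sym (cong (ι ∘ not) Xv))) (term≤∑ (ι ∘ not ∘ X) v)) (≮⇒≥ out≮)
    same-side : ∀ {a b} → Connected (∁ S) a b → X a ≡ true → X b ≡ true
    same-side ε Xa = Xa
    same-side ((e , e∈ , false , refl , refl) ◅ c) Xa =
      same-side c (trans (sym (xor-false _ _ (∈∁S⁻ e e∈))) Xa)
    same-side ((e , e∈ , true , refl , refl) ◅ c) Xa =
      same-side c (trans (xor-false _ _ (∈∁S⁻ e e∈)) Xa)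

-- Deletable edges from flows.

module Deletion (G : Graph) where
  open Graph G
  open Counting G
  open Components G
  open Cuts G

  leaves enters : Orientation → (Vertex → Bool) → Edge → Bool
  leaves o X e = X (tail o e) ∧ not (X (head o e))
  enters o X e = not (X (tail o e)) ∧ X (head o e)

  leaves⇒ : ∀ o X e → leaves o X e ≡ true → X (tail o e) ≡ true × X (head o e) ≡ false
  leaves⇒ o X e eq with X (tail o e) | X (head o e)
  ... | true | false = refl , refl

  enters⇒ : ∀ o X e → enters o X e ≡ true → X (tail o e) ≡ false × X (head o e) ≡ true
  enters⇒ o X e eq with X (tail o e) | X (head o e)
  ... | false | true = refl , refl

  -- Nothing is demanded of `f` itself: it may leave `X` or not.
  OnlyExit : Orientation → (Vertex → Bool) → Edge → Set
  OnlyExit o X f = ∀ g → g ≢ f → leaves o X g ≡ false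

  -- If `v` cannot be reached from `u` without `f`, the set reachable from `u` is left by no edge
  -- other than `f`.
  deletable-criterion : ∀ o f →
    (∀ X {u v} → X u ≡ true → X v ≡ false → OnlyExit o X f → ⊥) → Deletable o f
  deletable-criterion o f no-cut u v _
    with Reachability.reach-or-cut (Arc o (⊤ - f)) (arc? o (⊤ - f)) u v
  ... | inj₁ path = path
  ... | inj₂ (X , Xu , Xv , closed) = ⊥-elim (no-cut X Xu Xv only)
    where
    only : OnlyExit o X f
    only g g≢f = Bool.¬-not λ out → let Xt , Xh = leaves⇒ o X g out in
      true≢false (trans (sym (closed (g , x∈p∧x≢y⇒x∈p-y ∈⊤ g≢f , refl , refl) Xt)) Xh)

  -- As `e₀` carries no flow, conservation does not constrain its direction. The price is one
  -- crossing edge per cut that the flow cannot detect.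
  record NearlyPositiveFlow (D : Orientation) (φ : Edge → ℕ) (e₀ : Edge) : Set where
    field
      conservation : ∀ (W : Vertex → ℕ) →
        ∑ (λ e → φ e * W (tail D e)) ≡ ∑ (λ e → φ e * W (head D e))
      zero-at  : φ e₀ ≡ 0
      positive : ∀ f → f ≢ e₀ → 1 ≤ φ f

  module _ (cec : CyclicallyEdgeConnected 4) (cubic : Cubic)
           {D : Orientation} {φ : Edge → ℕ} {e₀ : Edge}
           (flow : NearlyPositiveFlow D φ e₀) where
    open NearlyPositiveFlow flow

    crosses-split : ∀ X e → ι (crosses X e) ≡ ι (leaves D X e) + ι (enters D X e)
    crosses-split X e with D e
    ... | false = lemma (X (end e false)) (X (end e true))
      where
      lemma : ∀ a b → ι (a xor b) ≡ ι (a ∧ not b) + ι (not a ∧ b)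
      lemma true  true  = refl
      lemma true  false = refl
      lemma false true  = refl
      lemma false false = refl
    ... | true = lemma (X (end e false)) (X (end e true))
      where
      lemma : ∀ a b → ι (a xor b) ≡ ι (b ∧ not a) + ι (not b ∧ a)
      lemma true  true  = refl
      lemma true  false = refl
      lemma false true  = refl
      lemma false false = refl

    module _ (X : Vertex → Bool) {f : Edge} (only : OnlyExit D X f) where

      -- Conservation against the indicator of `X`: the inflow equals the outflow, and only `f` can
      -- carry outflow.
      inflow : ∑ (λ e → φ e * ι (enters D X e)) ≡ φ f * ι (leaves D X f)
      inflow = +-cancelˡ-≡ (∑ λ e → φ e * ι (X (tail D e))) _ _ (begin
        ∑ (λ e → φ e * ι (X (tail D e))) + ∑ (λ e → φ e * ι (enters D X e))
          ≡⟨ ∑-balance (λ e → lemma (φ e) (X (tail D e)) (X (head D e))) ⟩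
        ∑ (λ e → φ e * ι (X (head D e))) + ∑ (λ e → φ e * ι (leaves D X e))
          ≡⟨ cong₂ _+_ (sym (conservation (ι ∘ X)))
               (∑-support f λ g g≢f → trans (cong (λ b → φ g * ι b) (only g g≢f)) (*-zeroʳ (φ g))) ⟩
        ∑ (λ e → φ e * ι (X (tail D e))) + φ f * ι (leaves D X f) ∎)
        where
        open ≡-Reasoning
        lemma : ∀ n a b → n * ι a + n * ι (not a ∧ b) ≡ n * ι b + n * ι (a ∧ not b)
        lemma n true  true  = refl
        lemma n true  false = +-comm (n * 1) (n * 0)
        lemma n false true  = +-comm (n * 0) (n * 1)
        lemma n false false = refl

      -- A crossing edge is `f`, or `e₀` entering, or an entering edge that uses up at least one
      -- unit of the inflow.
      cut-bound : ∑ (ι ∘ crosses X) ≤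
                  ι (leaves D X f) + (φ f * ι (leaves D X f) + ι (enters D X e₀))
      cut-bound = begin
        ∑ (ι ∘ crosses X)
          ≡⟨ trans (∑-cong (crosses-split X)) (∑-+ (ι ∘ leaves D X) (ι ∘ enters D X)) ⟩
        ∑ (ι ∘ leaves D X) + ∑ (ι ∘ enters D X)
          ≤⟨ +-mono-≤ (≤-reflexive (∑-support f λ g g≢f → cong ι (only g g≢f))) (∑-mono in≤) ⟩
        ι (leaves D X f) + ∑ (λ e → φ e * ι (enters D X e) + ι (e == e₀) * ι (enters D X e₀))
          ≡⟨ cong (ι (leaves D X f) +_) (trans
               (∑-+ (λ e → φ e * ι (enters D X e)) (λ e → ι (e == e₀) * ι (enters D X e₀)))
               (cong₂ _+_ inflow (∑-δ e₀ (ι (enters D X e₀))))) ⟩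
        ι (leaves D X f) + (φ f * ι (leaves D X f) + ι (enters D X e₀)) ∎
        where
        open ≤-Reasoning
        in≤ : ∀ e → ι (enters D X e) ≤ φ e * ι (enters D X e) + ι (e == e₀) * ι (enters D X e₀)
        in≤ e with e ≟ e₀
        ... | yes refl = ≤-trans (≤-reflexive (sym (+-identityʳ _))) (m≤n+m _ (φ e * ι (enters D X e)))
        ... | no  e≢e₀ = ≤-trans (≤-reflexive (sym (*-identityˡ _)))
                           (≤-trans (*-monoˡ-≤ _ (positive e e≢e₀)) (m≤m+n _ _))

    module _ (X : Vertex → Bool) {u v} (Xu : X u ≡ true) (Xv : X v ≡ false) where

      3≤cut : 3 ≤ ∑ (ι ∘ crosses X)
      3≤cut with ∑ (ι ∘ crosses X) ≤? 3
      ... | yes d≤3 = ≤-reflexive (sym (proj₁ (small-cut cec cubic X Xu Xv d≤3)))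
      ... | no  d≰3 = <⇒≤ (≰⇒> d≰3)

      data Trivial : Set where
        singleton   : (∀ {a b} → X a ≡ true  → X b ≡ true  → a ≡ b) → Trivial
        cosingleton : (∀ {a b} → X a ≡ false → X b ≡ false → a ≡ b) → Trivial

      trivial : ∑ (ι ∘ crosses X) ≤ 3 → Trivial
      trivial d≤3 with small-cut cec cubic X Xu Xv d≤3
      ... | _ , inj₁ one = singleton (∑-singleton X one)
      ... | _ , inj₂ one = cosingleton λ Xa Xb → ∑-singleton (not ∘ X) one (cong not Xa) (cong not Xb)

    -- The bound is 1 + 1, plus 1 if `e₀` enters `X`. As every cut has three edges, `e₀` must enter
    -- and the cut is a star. If `X` is one vertex, `f` leaves the head of `e₀`; if the complement
    -- is one vertex, `f` enters the tail of `e₀`.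
    unit-deletable : ∀ {f} → φ f ≡ 1 → tail D f ≢ head D e₀ → head D f ≢ tail D e₀ → Deletable D f
    unit-deletable {f} φf t≢ h≢ = deletable-criterion D f no-cut
      where
      no-cut : ∀ X {u v} → X u ≡ true → X v ≡ false → OnlyExit D X f → ⊥
      no-cut X Xu Xv only with leaves D X f in out | enters D X e₀ in inn
                             | cut-bound X only | 3≤cut X Xu Xv
      -- If `f` does not leave `X` either, the inflow vanishes and only `e₀` can cross.
      ... | false | i     | bound | 3≤ rewrite *-zeroʳ (φ f) =
        contradiction (≤-trans 3≤ (≤-trans bound (ι≤1 i))) λ { (s≤s ()) }
      ... | true  | false | bound | 3≤ rewrite φf = contradiction (≤-trans 3≤ bound) λ { (s≤s (s≤s ())) }
      ... | true  | true  | bound | _  rewrite φf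
        with trivial X Xu Xv bound | leaves⇒ D X f out | enters⇒ D X e₀ inn
      ...   | singleton eq   | Xt , _  | _ , Xh₀ = t≢ (eq Xt Xh₀)
      ...   | cosingleton eq | _  , Xh | Xt₀ , _ = h≢ (eq Xh Xt₀)

    zero-deletable : Deletable D e₀
    zero-deletable = deletable-criterion D e₀ no-cut
      where
      no-cut : ∀ X {u v} → X u ≡ true → X v ≡ false → OnlyExit D X e₀ → ⊥
      no-cut X Xu Xv only with ≤-trans (3≤cut X Xu Xv) (cut-bound X only)
      ... | 3≤ rewrite zero-at = contradiction
        (≤-trans 3≤ (+-mono-≤ (ι≤1 (leaves D X e₀)) (ι≤1 (enters D X e₀)))) λ { (s≤s (s≤s ())) }

    record Exit (X : Vertex → Bool) (f : Edge) : Set where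
      field
        tail-in   : X (tail D f) ≡ true
        head-out  : X (head D f) ≡ false
        no-entry  : ∀ m → 3 ≤ φ m → ¬ (X (tail D m) ≡ false × X (head D m) ≡ true)
        is-single : Trivial X tail-in head-out

    -- The shared end puts the tail of `e₀` inside `X` or its head outside, so `e₀` does not enter
    -- and the cut has at most 1 + 2 edges. The inflow is 2, hence no edge of value 3 enters.
    double-exit : ∀ {f X u v} → φ f ≡ 2 → tail D f ≡ tail D e₀ ⊎ head D f ≡ head D e₀ →
                  X u ≡ true → X v ≡ false → OnlyExit D X f → Exit X f
    double-exit {f} {X} φf at-e₀ Xu Xv only with leaves D X f in out | enters D X e₀ in inn
                                               | cut-bound X only | 3≤cut X Xu Xv | inflow X only
    ... | false | i     | bound | 3≤ | _ rewrite *-zeroʳ (φ f) =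
      contradiction (≤-trans 3≤ (≤-trans bound (ι≤1 i))) λ { (s≤s ()) }
    ... | true  | true  | _ | _ | _ with leaves⇒ D X f out | enters⇒ D X e₀ inn | at-e₀
    ...   | Xt , _ | Xt₀ , _ | inj₁ eq =
      contradiction (trans (sym Xt) (trans (cong X eq) Xt₀)) true≢false
    ...   | _ , Xh | _ , Xh₀ | inj₂ eq =
      contradiction (trans (sym Xh₀) (trans (cong X (sym eq)) Xh)) true≢false
    double-exit {f} {X} φf at-e₀ Xu Xv only | true | false | bound | _ | inflow≡ rewrite φf =
      record { tail-in = Xt ; head-out = Xh ; no-entry = light
             ; is-single = trivial X Xt Xh bound }
      where
      Xt : X (tail D f) ≡ true
      Xt = proj₁ (leaves⇒ D X f out)
      Xh : X (head D f) ≡ false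
      Xh = proj₂ (leaves⇒ D X f out)
      light : ∀ m → 3 ≤ φ m → ¬ (X (tail D m) ≡ false × X (head D m) ≡ true)
      light m 3≤φ (Xtm , Xhm) = contradiction
        (≤-trans 3≤φ (≤-trans (≤-reflexive (sym (trans
          (cong (φ m *_) (cong ι (cong₂ _∧_ (cong not Xtm) Xhm))) (*-identityʳ (φ m)))))
          (≤-trans (term≤∑ (λ e → φ e * ι (enters D X e)) m) (≤-reflexive inflow≡))))
        λ { (s≤s (s≤s ())) }

    module _ (x₁≢x₂ : tail D e₀ ≢ head D e₀) where

      -- If `X` is the tail of `f`, then `e₀` leaves `X` as well. If the complement of `X` is the
      -- head of `f`, then `m` enters `X` from there with value 3.
      double-deletable-tail : ∀ {f m} → f ≢ e₀ → φ f ≡ 2 → tail D f ≡ tail D e₀ →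
        3 ≤ φ m → tail D m ≡ head D f → tail D m ≢ head D m → Deletable D f
      double-deletable-tail {f} {m} f≢e₀ φf tf 3≤φ tm loopless = deletable-criterion D f no-cut
        where
        no-cut : ∀ X {u v} → X u ≡ true → X v ≡ false → OnlyExit D X f → ⊥
        no-cut X Xu Xv only with double-exit {X = X} φf (inj₁ tf) Xu Xv only
        ... | record { tail-in = Xt ; is-single = singleton eq } =
          true≢false (trans (sym (cong₂ (λ a b → a ∧ not b) (trans (cong X (sym tf)) Xt)
            (Bool.¬-not λ Xh₀ → x₁≢x₂ (trans (sym tf) (eq Xt Xh₀)))))
            (only e₀ (f≢e₀ ∘ sym)))
        ... | record { head-out = Xh ; no-entry = light ; is-single = cosingleton eq } =
          light m 3≤φ (trans (cong X tm) Xh ,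
            Bool.¬-not λ Xhm → loopless (trans tm (eq Xh Xhm)))

      -- The previous argument with all directions reversed: now the complement being the head of
      -- `f` makes `e₀` leave, and `X` being the tail of `f` makes `m` enter.
      double-deletable-head : ∀ {f m} → f ≢ e₀ → φ f ≡ 2 → head D f ≡ head D e₀ →
        3 ≤ φ m → head D m ≡ tail D f → tail D m ≢ head D m → Deletable D f
      double-deletable-head {f} {m} f≢e₀ φf hf 3≤φ hm loopless = deletable-criterion D f no-cut
        where
        no-cut : ∀ X {u v} → X u ≡ true → X v ≡ false → OnlyExit D X f → ⊥
        no-cut X Xu Xv only with double-exit {X = X} φf (inj₂ hf) Xu Xv only
        ... | record { head-out = Xh ; is-single = cosingleton eq } =
          true≢false (trans (sym (cong₂ (λ a b → a ∧ not b)
            (Bool.¬-not λ Xt₀ → x₁≢x₂ (trans (eq Xt₀ Xh) hf)) (trans (cong X (sym hf)) Xh)))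
            (only e₀ (f≢e₀ ∘ sym)))
        ... | record { tail-in = Xt ; no-entry = light ; is-single = singleton eq } =
          light m 3≤φ (Bool.¬-not (λ Xtm → loopless (trans (eq Xtm Xt) (sym hm))) ,
            trans (cong X hm) Xt)

  -- The absolute value and the direction of f_A + 2 f_B on an edge, where f_A is zero or the
  -- unit flow in direction p and f_B is zero or the unit flow in direction q.
  value : Bool → Bool → Bool → Bool → ℕ
  value false _ false _ = 0
  value true  _ false _ = 1
  value false _ true  _ = 2
  value true  p true  q = if p xor q then 1 else 3

  direction : Bool → Bool → Bool → Bool → Bool → Bool
  direction _     _ true  q _ = q
  direction true  p false _ _ = p
  direction false _ false _ r = r

  value-positive : ∀ a p b q → (a ≡ false → b ≡ false → ⊥) → 1 ≤ value a p b q
  value-positive false p     false q     a∨b = ⊥-elim (a∨b refl refl)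
  value-positive true  p     false q     a∨b = ≤-refl
  value-positive false p     true  q     a∨b = s≤s z≤n
  value-positive true  true  true  true  a∨b = s≤s z≤n
  value-positive true  true  true  false a∨b = ≤-refl
  value-positive true  false true  true  a∨b = ≤-refl
  value-positive true  false true  false a∨b = s≤s z≤n

  module Combined (A : Edge → Bool) (oA : Orientation) (B : Edge → Bool) (oB : Orientation)
                  (r : Orientation) where

    φ : Edge → ℕ
    φ e = value (A e) (oA e) (B e) (oB e)

    D : Orientation
    D e = direction (A e) (oA e) (B e) (oB e) (r e)

    -- On each edge, `φ` times the drop of `W` along `D` equals the drop along `oA` plus twice the
    -- drop along `oB`. Adding `combination` to both sides states this without signs.
    conserved : Balanced A oA → Balanced B oB → ∀ (W : Vertex → ℕ) →
                ∑ (λ e → φ e * W (tail D e)) ≡ ∑ (λ e → φ e * W (head D e))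
    conserved balA balB W = +-cancelʳ-≡ (∑ λ e → combination e not) _ _ (begin
      ∑ (λ e → φ e * W (tail D e)) + ∑ (λ e → combination e not)
        ≡⟨ ∑-balance (λ e → lemma (A e) (oA e) (B e) (oB e) (r e) (W ∘ end e)) ⟩
      ∑ (λ e → φ e * W (head D e)) + ∑ (λ e → combination e (λ b → b))
        ≡⟨ cong (∑ (λ e → φ e * W (head D e)) +_) combination≡ ⟩
      ∑ (λ e → φ e * W (head D e)) + ∑ (λ e → combination e not) ∎)
      where
      open ≡-Reasoning
      combination : Edge → (Bool → Bool) → ℕ
      combination e s = ι (A e) * W (end e (s (oA e))) + 2 * (ι (B e) * W (end e (s (oB e))))
      expand : ∀ s → ∑ (λ e → combination e s) ≡
        ∑ (λ e → ι (A e) * W (end e (s (oA e)))) + 2 * ∑ (λ e → ι (B e) * W (end e (s (oB e))))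
      expand s = trans (∑-+ (λ e → ι (A e) * W (end e (s (oA e)))) _)
        (cong (∑ (λ e → ι (A e) * W (end e (s (oA e)))) +_)
              (sym (*-∑ 2 λ e → ι (B e) * W (end e (s (oB e))))))
      combination≡ : ∑ (λ e → combination e (λ b → b)) ≡ ∑ (λ e → combination e not)
      combination≡ = trans (expand (λ b → b))
        (trans (cong₂ _+_ (balanced-∑ A oA balA W) (cong (2 *_) (balanced-∑ B oB balB W)))
               (sym (expand not)))
      onlyA : ∀ x y → 1 * x + (1 * y + 2 * 0) ≡ 1 * y + (1 * x + 2 * 0)
      onlyA = solve-∀
      onlyB : ∀ x y → 2 * x + (0 + 2 * (1 * y)) ≡ 2 * y + (0 + 2 * (1 * x))
      onlyB = solve-∀
      agree : ∀ x y → 3 * x + (1 * y + 2 * (1 * y)) ≡ 3 * y + (1 * x + 2 * (1 * x))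
      agree = solve-∀
      disagree : ∀ x y → 1 * x + (1 * x + 2 * (1 * y)) ≡ 1 * y + (1 * y + 2 * (1 * x))
      disagree = solve-∀
      lemma : ∀ a p b q t (g : Bool → ℕ) →
        value a p b q * g (direction a p b q t) + (ι a * g (not p) + 2 * (ι b * g (not q))) ≡
        value a p b q * g (not (direction a p b q t)) + (ι a * g p + 2 * (ι b * g q))
      lemma false p     false q     t g = refl
      lemma true  p     false q     t g = onlyA (g p) (g (not p))
      lemma false p     true  q     t g = onlyB (g q) (g (not q))
      lemma true  false true  false t g = agree (g false) (g true)
      lemma true  true  true  true  t g = agree (g true) (g false)
      lemma true  false true  true  t g = disagree (g true) (g false)
      lemma true  true  true  false t g = disagree (g false) (g true)

-- Component representatives and alternating matchings in a 2-factor.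

pick : {A : Set} → (A → Bool) → A → List A → A
pick b d []       = d
pick b d (x ∷ xs) = if b x then x else pick b d xs

pick-holds : {A : Set} (b : A → Bool) {d : A} → b d ≡ true → ∀ xs → b (pick b d xs) ≡ true
pick-holds b bd []       = bd
pick-holds b bd (x ∷ xs) with b x in bx
... | true  = bx
... | false = pick-holds b bd xs

-- The defaults may differ because the search succeeds in both cases; so a representative found from
-- different vertices of one component is the same.
pick-cong : {A : Set} {b c : A → Bool} → (∀ x → b x ≡ c x) → ∀ {d d′ x xs} →
            x ∈ˡ xs → b x ≡ true → pick b d xs ≡ pick c d′ xs
pick-cong b≗c {xs = y ∷ _} (here refl) bx rewrite sym (b≗c y) | bx = refl
pick-cong {b = b} b≗c {xs = y ∷ _} (there x∈) bx rewrite sym (b≗c y) with b y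
... | true  = refl
... | false = pick-cong b≗c x∈ bx

module TwoFactors (G : Graph) where
  open Graph G
  open Counting G
  open Components G

  module Directed (C : EdgeSet) (o : Orientation)
                  (two : ∀ w → deg (lookup C) w ≡ 2) (smooth : IsSmooth C o) where

    out≡1 : ∀ w → at (lookup C) o w ≡ 1
    out≡1 w = proj₂ (smooth-at C o smooth (λ v → inj₂ (two v)) w (two w))

    in≡1 : ∀ w → at (lookup C) (not ∘ o) w ≡ 1
    in≡1 w = proj₁ (smooth-at C o smooth (λ v → inj₂ (two v)) w (two w))

    balanced : Balanced (lookup C) o
    balanced w = trans (out≡1 w) (sym (in≡1 w))

    ∃!out : ∀ w → ∃[ q ] ((lookup C q ∧ tail o q == w) ≡ true ×
              ∀ e → (lookup C e ∧ tail o e == w) ≡ true → e ≡ q)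
    ∃!out w = ∑-unique (λ e → lookup C e ∧ tail o e == w)
      (trans (∑-cong λ e → ι-∧ (lookup C e) (tail o e == w)) (out≡1 w))

    opaque
      out : Vertex → Edge
      out w = proj₁ (∃!out w)

      out∈C : ∀ w → lookup C (out w) ≡ true
      out∈C w = proj₁ (∧-true (proj₁ (proj₂ (∃!out w))))

      tail-out : ∀ w → tail o (out w) ≡ w
      tail-out w = ==⇒≡ _ _ (proj₂ (∧-true {lookup C (out w)} (proj₁ (proj₂ (∃!out w)))))

      out-unique : ∀ {e} → lookup C e ≡ true → e ≡ out (tail o e)
      out-unique {e} e∈C = proj₂ (proj₂ (∃!out (tail o e))) e (cong₂ _∧_ e∈C (==-refl (tail o e)))

    next : Vertex → Vertex
    next w = head o (out w)

    next-tail : ∀ {e} → lookup C e ≡ true → next (tail o e) ≡ head o e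
    next-tail e∈C = cong (head o) (sym (out-unique e∈C))

    arc : ∀ {e} → e ∈ C → Connected C (tail o e) (head o e)
    arc e∈C = adjacent e∈C (o _) ◅ ε

    -- A set closed under the arcs of C has, by balance, no arc of C entering it either.
    connected⇒directed : ∀ {u v} → Connected C u v → Star (Arc o C) u v
    connected⇒directed {u} {v} u~v
      with Reachability.reach-or-cut (Arc o C) (arc? o C) u v
    ... | inj₁ path = path
    ... | inj₂ (X , Xu , Xv , closed) =
      contradiction (trans (sym (preserved u~v Xu)) Xv) true≢false
      where
      mono : ∀ e → ι (lookup C e) * ι (X (tail o e)) ≤ ι (lookup C e) * ι (X (head o e))
      mono e with lookup C e in e∈C | X (tail o e) in Xt
      ... | false | _     = z≤n
      ... | true  | false = z≤n
      ... | true  | true  rewrite closed (e , lookup⇒[]= e C e∈C , refl , refl) Xt = ≤-refl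
      same : ∀ {e} → e ∈ C → X (tail o e) ≡ X (head o e)
      same {e} e∈C = ι-injective (X (tail o e)) (X (head o e)) (subst
        (λ c → ι c * ι (X (tail o e)) ≡ ι c * ι (X (head o e))) ([]=⇒lookup e∈C)
        (∑-squeeze mono (≤-reflexive (sym (balanced-∑ (lookup C) o balanced (ι ∘ X)))) e))
        where
        ι-injective : ∀ a b → 1 * ι a ≡ 1 * ι b → a ≡ b
        ι-injective true  true  _ = refl
        ι-injective false false _ = refl
      same-ends : ∀ {e} → e ∈ C → ∀ b → X (end e b) ≡ X (end e (not b))
      same-ends {e} e∈C b with o e | same e∈C | b
      ... | false | eq | false = eq
      ... | false | eq | true  = sym eq
      ... | true  | eq | false = sym eq
      ... | true  | eq | true  = eq
      preserved : ∀ {a b} → Connected C a b → X a ≡ true → X b ≡ true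
      preserved ε Xa = Xa
      preserved ((e , e∈C , b , refl , refl) ◅ c) Xa = preserved c (trans (sym (same-ends e∈C b)) Xa)

    module Rooted (x₁ x₂ : Vertex) (x₁≁x₂ : ¬ Connected C x₁ x₂) where

      conn : Vertex → Vertex → Bool
      conn u v = does (connected? C u v)

      opaque
        -- Listing `x₁` and `x₂` first makes each of them the representative of its own circuit; any
        -- other circuit is represented by its first vertex.
        root : Vertex → Vertex
        root v = pick (conn v) v (x₁ ∷ x₂ ∷ allFin order)

        conn-refl : ∀ v → conn v v ≡ true
        conn-refl v = dec-true (connected? C v v) ε

        root-connected : ∀ v → Connected C v (root v)
        root-connected v = does⇒ (connected? C v (root v))
          (pick-holds (conn v) (conn-refl v) (x₁ ∷ x₂ ∷ allFin order))

        conn-cong : ∀ {u v} → Connected C u v → ∀ w → conn u w ≡ conn v w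
        conn-cong {u} {v} u~v w with connected? C v w
        ... | yes v~w = dec-true  (connected? C u w) (u~v ◅◅ v~w)
        ... | no  v≁w = dec-false (connected? C u w) λ u~w → v≁w (connected-sym u~v ◅◅ u~w)

        root-cong : ∀ {u v} → Connected C u v → root u ≡ root v
        root-cong {u} u~v = pick-cong (conn-cong u~v) (there (there (∈-allFin u))) (conn-refl u)

        root-x₁ : root x₁ ≡ x₁
        root-x₁ rewrite conn-refl x₁ = refl

        root-x₂ : root x₂ ≡ x₂
        root-x₂ rewrite dec-false (connected? C x₂ x₁) (x₁≁x₂ ∘ connected-sym) | conn-refl x₂ = refl

      root-idem : ∀ v → root (root v) ≡ root v
      root-idem v = root-cong (connected-sym (root-connected v))

      -- p is the parity of the distance along o to the root, so it alternates except possibly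
      -- on the arc leaving the root.
      data Descent : Vertex → Set where
        stop : ∀ {v} → root v ≡ v → Descent v
        step : ∀ {v} → root v ≢ v → Descent (next v) → Descent v

      descend : ∀ {v r} → Star (Arc o C) v r → root r ≡ r → Descent v
      descend ε isRoot = stop isRoot
      descend {v} ((e , e∈C , refl , refl) ◅ path) isRoot with root v ≟ v
      ... | yes eq = stop eq
      ... | no  ≢v = step ≢v (subst Descent (sym (next-tail ([]=⇒lookup e∈C))) (descend path isRoot))

      descent : ∀ v → Descent v
      descent v = descend (connected⇒directed (root-connected v)) (root-idem v)

      parity : ∀ {v} → Descent v → Bool
      parity (stop _)   = false
      parity (step _ d) = not (parity d)

      parity-unique : ∀ {v} (d d′ : Descent v) → parity d ≡ parity d′
      parity-unique (stop _)   (stop _)    = refl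
      parity-unique (stop eq)  (step ≢v _) = contradiction eq ≢v
      parity-unique (step ≢v _) (stop eq)  = contradiction eq ≢v
      parity-unique (step _ d) (step _ d′) = cong not (parity-unique d d′)

      opaque
        p : Vertex → Bool
        p v = parity (descent v)

        p-root : ∀ {v} → root v ≡ v → p v ≡ false
        p-root {v} eq = parity-unique (descent v) (stop eq)

        p-next : ∀ {v} → root v ≢ v → p v ≡ not (p (next v))
        p-next {v} ≢v = parity-unique (descent v) (step ≢v (descent (next v)))

      -- Balance makes p hold at as many heads as tails; hence only the arc leaving the root
      -- can make the number of arcs odd.
      component-size : ∀ {r} → root r ≡ r →
        Σ[ t ∈ ℕ ] ∣ component C r ∣ ≡ (t + t) + ι (not (p (next r)))
      component-size {r} isRoot = ∑ (λ e → ι (lookup C e) * W (head o e)) , (begin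
        ∣ K ∣                         ≡⟨ card K ⟩
        ∑ (ι ∘ lookup K)              ≡⟨ ∑-cong term ⟩
        ∑ (λ e → (ι (lookup C e) * W (head o e) + ι (lookup C e) * W (tail o e)) + ι (e == q) * defect)
          ≡⟨ trans (∑-+ (λ e → ι (lookup C e) * W (head o e) + ι (lookup C e) * W (tail o e))
                        (λ e → ι (e == q) * defect))
                   (cong₂ _+_ (∑-+ (λ e → ι (lookup C e) * W (head o e)) _) (∑-δ q defect)) ⟩
        (∑ (λ e → ι (lookup C e) * W (head o e)) + ∑ (λ e → ι (lookup C e) * W (tail o e))) + defect
          ≡⟨ cong (λ s → (∑ (λ e → ι (lookup C e) * W (head o e)) + s) + defect)
                  (balanced-∑ (lookup C) o balanced W) ⟩
        (∑ (λ e → ι (lookup C e) * W (head o e)) + ∑ (λ e → ι (lookup C e) * W (head o e))) + defect ∎)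
        where
        open ≡-Reasoning
        K : EdgeSet
        K = component C r
        q : Edge
        q = out r
        defect : ℕ
        defect = ι (not (p (next r)))
        W : Vertex → ℕ
        W v = ι (conn r v ∧ p v)
        -- An arc of the circuit other than `q` has `p` at exactly one end and is counted once. On
        -- `q` the tail is not counted, and `defect` supplies the missing unit when the head is not
        -- counted either.
        Term : (k c h t q d : Bool) → Set
        Term k c h t q d = ι k ≡ (ι c * ι h + ι c * ι t) + ι q * ι d
        absent : ∀ {k c q} h t d → k ≡ false → c ≡ false → q ≡ false → Term k c h t q d
        absent h t d refl refl refl = refl
        far : ∀ {k h t q} c d → k ≡ false → h ≡ false → t ≡ false → q ≡ false → Term k c h t q d
        far true  d refl refl refl refl = refl
        far false d refl refl refl refl = refl
        initial : ∀ {k c h t q} b → k ≡ true → c ≡ true → h ≡ b → t ≡ false → q ≡ true →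
                  Term k c h t q (not b)
        initial true  refl refl refl refl refl = refl
        initial false refl refl refl refl refl = refl
        later : ∀ {k c h t q} b d → k ≡ true → c ≡ true → h ≡ b → t ≡ not b → q ≡ false →
                Term k c h t q d
        later true  d refl refl refl refl refl = refl
        later false d refl refl refl refl refl = refl
        conn-true : ∀ {v} → Connected C r v → conn r v ∧ p v ≡ p v
        conn-true {v} r~v = cong (_∧ p v) (dec-true (connected? C r v) r~v)
        conn-false : ∀ {v} → ¬ Connected C r v → conn r v ∧ p v ≡ false
        conn-false {v} r≁v = cong (_∧ p v) (dec-false (connected? C r v) r≁v)
        K-false : ∀ e → (e ∈ C → Connected C r (tail o e) → ⊥) → lookup K e ≡ false
        K-false e ∉K = Bool.¬-not λ e∈K → let e∈C , r~e = component⁻ C r (lookup⇒[]= e K e∈K) in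
          ∉K e∈C (r~e (o e))
        term : ∀ e → Term (lookup K e) (lookup C e) (conn r (head o e) ∧ p (head o e))
                          (conn r (tail o e) ∧ p (tail o e)) (e == q) (not (p (next r)))
        term e = go (e ∈? C) (connected? C r (tail o e)) (e ≟ q)
          where
          go : Dec (e ∈ C) → Dec (Connected C r (tail o e)) → Dec (e ≡ q) →
               Term (lookup K e) (lookup C e) (conn r (head o e) ∧ p (head o e))
                    (conn r (tail o e) ∧ p (tail o e)) (e == q) (not (p (next r)))
          go (no e∉C) _ _ = absent (conn r (head o e) ∧ p (head o e))
            (conn r (tail o e) ∧ p (tail o e)) (not (p (next r))) (K-false e λ e∈C _ → e∉C e∈C)
            (Bool.¬-not (e∉C ∘ lookup⇒[]= e C))
            (≢⇒== λ e≡q → e∉C (subst (_∈ C) (sym e≡q) (lookup⇒[]= q C (out∈C r))))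
          go (yes e∈C) (no r≁t) _ = far (lookup C e) (not (p (next r))) (K-false e λ _ r~t → r≁t r~t)
            (conn-false λ r~h → r≁t (r~h ◅◅ connected-sym (arc e∈C))) (conn-false r≁t)
            (≢⇒== λ e≡q → r≁t (subst (Connected C r) (sym (trans (cong (tail o) e≡q) (tail-out r))) ε))
          go (yes e∈C) (yes r~t) e≟q with []=⇒lookup e∈C | r~t ◅◅ arc e∈C
          go (yes e∈C) (yes r~t) (yes e≡q) | ce | r~h = initial (p (next r))
            (trans (lookup-component C r r~t e (o e) refl) ce) ce
            (trans (conn-true r~h) (cong (p ∘ head o) e≡q))
            (trans (conn-true r~t) (trans (cong (p ∘ tail o) e≡q)
              (trans (cong p (tail-out r)) (p-root isRoot))))
            (trans (cong (_== q) e≡q) (==-refl q))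
          go (yes e∈C) (yes r~t) (no e≢q) | ce | r~h = later (p (head o e)) (not (p (next r)))
            (trans (lookup-component C r r~t e (o e) refl) ce) ce
            (conn-true r~h)
            (trans (conn-true r~t) (trans (p-next λ eq → e≢q (trans (out-unique ce)
              (cong out (trans (sym eq) (trans (sym (root-cong r~t)) isRoot)))))
              (cong (not ∘ p) (next-tail ce))))
            (≢⇒== e≢q)

      2∣t+t : ∀ t → 2 ∣ t + t
      2∣t+t t = divides t (trans (cong (t +_) (sym (+-identityʳ t))) (*-comm 2 t))

      odd-root : ∀ {r} → root r ≡ r → Odd (component C r) → p (next r) ≡ false
      odd-root {r} isRoot odd with component-size isRoot
      ... | t , size≡ with p (next r)
      ...   | false = refl
      ...   | true  = contradiction (subst (2 ∣_) (sym (trans size≡ (+-identityʳ _))) (2∣t+t t)) odd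

      even-root : ∀ {r} → root r ≡ r → 2 ∣ ∣ component C r ∣ → p (next r) ≡ true
      even-root {r} isRoot even with component-size isRoot
      ... | t , size≡ with p (next r)
      ...   | true  = refl
      ...   | false = contradiction (∣1⇒≡1 (∣m+n∣m⇒∣n (subst (2 ∣_) size≡ even) (2∣t+t t))) λ ()

      -- Takes every second arc. At a vertex other than a root, `p` differs from its value at the
      -- successor, so exactly one of the two arcs is taken. At a root the incoming arc is never
      -- taken, and the outgoing one is taken just when the circuit is even.
      matched : Edge → Bool
      matched e = lookup C e ∧ p (head o e)

      deg-matched : ∀ w → deg matched w ≡ ι (p (next w)) + ι (p w)
      deg-matched w = trans (deg-split matched o w) (cong₂ _+_ outgoing incoming)
        where
        filtered : ∀ o′ c → at (lookup C) o′ w ≡ 1 →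
                   at (λ e → lookup C e ∧ c) o′ w ≡ ι c
        filtered o′ true  one = trans (at-cong o′ w λ e _ → Bool.∧-identityʳ (lookup C e)) one
        filtered o′ false one = ∑-zero λ e →
          cong (λ b → ι b * ι (end e (o′ e) == w)) (Bool.∧-zeroʳ (lookup C e))
        incoming : at matched (not ∘ o) w ≡ ι (p w)
        incoming = trans (at-cong (not ∘ o) w λ e h≡w → cong (λ v → lookup C e ∧ p v) h≡w)
                         (filtered (not ∘ o) (p w) (in≡1 w))
        outgoing : at matched o w ≡ ι (p (next w))
        outgoing = trans (at-cong o w same) (filtered o (p (next w)) (out≡1 w))
          where
          same : ∀ e → tail o e ≡ w → matched e ≡ lookup C e ∧ p (next w)
          same e refl with lookup C e in e∈C
          ... | false = refl
          ... | true  = cong p (sym (next-tail e∈C))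

      deg-matched-odd-root : ∀ {r} → root r ≡ r → Odd (component C r) → deg matched r ≡ 0
      deg-matched-odd-root {r} isRoot odd
        rewrite deg-matched r | odd-root isRoot odd | p-root isRoot = refl

      deg-matched-even-root : ∀ {r} → root r ≡ r → 2 ∣ ∣ component C r ∣ → deg matched r ≡ 1
      deg-matched-even-root {r} isRoot even
        rewrite deg-matched r | even-root isRoot even | p-root isRoot = refl

      deg-matched-nonroot : ∀ {v} → root v ≢ v → deg matched v ≡ 1
      deg-matched-nonroot {v} ≢v rewrite deg-matched v | p-next ≢v = ι-not (p (next v))

  -- A vertex of `N` already has degree 2 in `N`, so all edges of `C` there lie in `N` and a walk in
  -- `C` cannot leave it.
  circuit≡component : ∀ C → (∀ w → deg (lookup C) w ≡ 2) → ∀ N → N CircuitOf C →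
                      ∀ {x} → x ∈V N → N ≡ component C x
  circuit≡component C two N (circuit , N⊆C) {x} x∈N = ⊆-antisym N⊆K K⊆N
    where
    open IsCircuit circuit
    N⊆K : N ⊆ component C x
    N⊆K {f} f∈N = ∈component C x {b = false} (N⊆C f∈N)
      (connected-mono N⊆C (connected x _ x∈N (∈V⁺ f∈N (false , refl))))
    N≤C : ∀ e → ι (lookup N e) ≤ ι (lookup C e)
    N≤C e with lookup N e in e∈N
    ... | false = z≤n
    ... | true rewrite []=⇒lookup (N⊆C (lookup⇒[]= e N e∈N)) = ≤-refl
    saturated : ∀ {w e b} → w ∈V N → e ∈ C → end e b ≡ w → e ∈ N
    saturated {w} {e} {b} w∈N e∈C eq = lookup⇒[]= e N (deg-saturated w N≤C
      (trans (trans (sym (degree≡deg N w)) (regular w w∈N)) (sym (two w))) e b eq ([]=⇒lookup e∈C))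
    stays : ∀ {u w} → u ∈V N → Connected C u w → w ∈V N
    stays u∈N ε = u∈N
    stays u∈N ((e , e∈C , b , refl , refl) ◅ c) =
      stays (∈V⁺ (saturated u∈N e∈C refl) (not b , refl)) c
    K⊆N : component C x ⊆ N
    K⊆N {f} f∈K with component⁻ C x f∈K
    ... | f∈C , c = saturated (stays x∈N (c false)) f∈C refl

-- Linearity of degrees, absence of loops, and the lower bound.

module Theorem (G : Graph) where
  open Graph G
  open Counting G
  open Components G
  open Cuts G
  open Deletion G
  open TwoFactors G

  deg-balance : ∀ (a b c d : Edge → Bool) → (∀ f → ι (a f) + ι (b f) ≡ ι (c f) + ι (d f)) →
                ∀ w → deg a w + deg b w ≡ deg c w + deg d w
  deg-balance a b c d eq w = begin
    deg a w + deg b w                              ≡⟨ interchange (at a (const false) w) _ _ _ ⟩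
    (at a (const false) w + at b (const false) w) + (at a (const true) w + at b (const true) w)
      ≡⟨ cong₂ _+_ (at-balance (const false)) (at-balance (const true)) ⟩
    (at c (const false) w + at d (const false) w) + (at c (const true) w + at d (const true) w)
      ≡⟨ interchange (at c (const false) w) _ _ _ ⟨
    deg c w + deg d w ∎
    where
    open ≡-Reasoning
    interchange : ∀ m n k l → (m + n) + (k + l) ≡ (m + k) + (n + l)
    interchange = solve-∀
    at-balance : ∀ o → at a o w + at b o w ≡ at c o w + at d o w
    at-balance o = ∑-balance λ f → let z = ι (end f (o f) == w) in
      trans (sym (*-distribʳ-+ z (ι (a f)) (ι (b f))))
            (trans (cong (_* z) (eq f)) (*-distribʳ-+ z (ι (c f)) (ι (d f))))

  deg-single : ∀ e b w → deg (_== e) w ≡ ι (end e b == w) + ι (end e (not b) == w)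
  deg-single e b w = trans (deg-split (_== e) (const b) w) (cong₂ _+_ (at-single b) (at-single (not b)))
    where
    at-single : ∀ c → at (_== e) (const c) w ≡ ι (end e c == w)
    at-single c = trans (∑-support e λ f f≢e → cong (λ x → ι x * ι (end f c == w)) (≢⇒== f≢e))
      (trans (cong (λ x → ι x * ι (end e c == w)) (==-refl e)) (*-identityˡ _))

  balanced-reverse : ∀ {h} {o : Orientation} → Balanced h o → Balanced h (not ∘ o)
  balanced-reverse {h} {o} bal w = trans (sym (bal w)) (∑-cong λ f →
    cong (λ b → ι (h f) * ι (end f b == w)) (sym (Bool.not-involutive (o f))))

  -- A loop uses two of the three degrees at its vertex, which leaves at most one edge in the cut
  -- around it. The other vertex `u` makes this cut proper, so it should have three edges.
  loopless : CyclicallyEdgeConnected 4 → Cubic → ∀ e {u} b → u ≢ end e b → end e b ≢ end e (not b)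
  loopless cec cubic e {u} b u≢v loop = contradiction
    (≤-trans (≤-reflexive (sym (proj₁ (small-cut cec cubic X {u = v} {v = u} (==-refl v) (≢⇒== u≢v)
      (≤-trans cut≤1 (s≤s z≤n)))))) cut≤1)
    λ { (s≤s ()) }
    where
    v : Vertex
    v = end e b
    X : Vertex → Bool
    X w = w == v
    inside : ℕ
    inside = ∑ λ f → ι (X (end f false) ∧ X (end f true))
    X-end : ∀ c → X (end e c) ≡ true
    X-end c = trans (cong X (both b c loop)) (==-refl v)
      where
      both : ∀ b c → end e b ≡ end e (not b) → end e c ≡ end e b
      both false false _  = refl
      both false true  eq = sym eq
      both true  false eq = sym eq
      both true  true  _  = refl
    1≤inside : 1 ≤ inside
    1≤inside = ≤-trans (≤-reflexive (sym (cong₂ (λ x y → ι (x ∧ y)) (X-end false) (X-end true))))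
                       (term≤∑ (λ f → ι (X (end f false) ∧ X (end f true))) e)
    X-size : ∑ (ι ∘ X) ≡ 1
    X-size = trans (∑-support v λ w w≢v → cong ι (≢⇒== w≢v)) (cong ι (==-refl v))
    cut≤1 : ∑ (ι ∘ crosses X) ≤ 1
    cut≤1 = +-cancelˡ-≤ 2 _ _ (≤-trans (+-monoˡ-≤ _ (+-mono-≤ 1≤inside 1≤inside))
      (≤-reflexive (trans (sym (cubic-count cubic X)) (cong (_* 3) X-size))))

  last-arc : ∀ {R : Vertex → Vertex → Set} {u v} → u ≢ v → Star R u v → ∃[ w ] R w v
  last-arc u≢v ε = contradiction refl u≢v
  last-arc {v = v} u≢v (_◅_ {j = w} r path) with w ≟ v
  ... | yes refl = _ , r
  ... | no  w≢v  = last-arc w≢v path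

  -- After the deletion of any edge, `x₁` still has an outgoing and an incoming edge. Deleting the
  -- ones found first yields two of each, so degree 4.
  no-universal-orientation : Cubic → ∀ {x₁ x₂} → x₁ ≢ x₂ → Edge → ∀ o → ¬ (∀ f → Deletable o f)
  no-universal-orientation cubic {x₁} {x₂} x₁≢x₂ e o del =
    contradiction (≤-trans (+-mono-≤ out≥2 in≥2)
      (≤-reflexive (trans (sym (deg-split (const true) o x₁)) (deg≡3 cubic x₁))))
    λ { (s≤s (s≤s (s≤s ()))) }
    where
    exit : ∀ f → ∃[ g ] (g ≢ f × tail o g ≡ x₁)
    exit f with del f x₁ x₂ x₁≢x₂
    ... | ε = contradiction refl x₁≢x₂
    ... | (g , g∈ , t≡ , _) ◅ _ = g , (λ { refl → x∈p─q⇒x∉q ⊤ ⁅ f ⁆ g∈ (x∈⁅x⁆ f) }) , t≡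
    entry : ∀ f → ∃[ g ] (g ≢ f × head o g ≡ x₁)
    entry f with last-arc (x₁≢x₂ ∘ sym) (del f x₂ x₁ (x₁≢x₂ ∘ sym))
    ... | _ , g , g∈ , _ , h≡ = g , (λ { refl → x∈p─q⇒x∉q ⊤ ⁅ f ⁆ g∈ (x∈⁅x⁆ f) }) , h≡
    out≥2 : 2 ≤ at (const true) o x₁
    out≥2 with exit e
    ... | g , _ , tg with exit g
    ...   | g′ , g′≢g , tg′ = 2≤at (const true) o x₁ g′≢g refl refl tg′ tg
    in≥2 : 2 ≤ at (const true) (not ∘ o) x₁
    in≥2 with entry e
    ... | g , _ , hg with entry g
    ...   | g′ , g′≢g , hg′ = 2≤at (const true) (not ∘ o) x₁ g′≢g refl refl hg′ hg

  -- The flows of the theorem and the two orientations.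

  module Main
    (cec : CyclicallyEdgeConnected 4) (cubic : Cubic)
    (C : EdgeSet) (twoFactor : IsTwoFactor C)
    (N₁ N₂ : EdgeSet) (N₁≢N₂ : N₁ ≢ N₂)
    (odd₁ : OddCircuitOf C N₁) (odd₂ : OddCircuitOf C N₂)
    (onlyOdd : ∀ N → OddCircuitOf C N → N ≡ N₁ ⊎ N ≡ N₂)
    (e : Edge) (b : Bool) (x₁∈N₁ : end e b ∈V N₁) (x₂∈N₂ : end e (not b) ∈V N₂)
    (M : EdgeSet) (maxM : IsMaximumMatching (deleteVertices C (end e b) (end e (not b))) M)
    (o₁ o₂ : Orientation)
    (smooth₁ : IsSmooth ((∁ C - e) ∪ M) o₁) (smooth₂ : IsSmooth C o₂)
    (agree : ∀ f → Z N₁ (end e b) f ⊎ Z N₂ (end e (not b)) f → o₁ f ≡ o₂ f)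
    where

    open IsMaximumMatching maxM

    x₁ x₂ : Vertex
    x₁ = end e b
    x₂ = end e (not b)

    two : ∀ w → deg (lookup C) w ≡ 2
    two w = trans (sym (degree≡deg C w)) (twoFactor w)

    N₁≡ : ∀ {x} → x ∈V N₁ → N₁ ≡ component C x
    N₁≡ = circuit≡component C two N₁ (proj₁ odd₁)

    N₂≡ : ∀ {x} → x ∈V N₂ → N₂ ≡ component C x
    N₂≡ = circuit≡component C two N₂ (proj₁ odd₂)

    ∈V-own-component : ∀ {v w} → Connected C v w → w ∈V component C v
    ∈V-own-component {v} {w} c = deg-2⇒∈V (component C v) w (trans (deg-component C v c) (two w))

    -- Otherwise `x₂` would lie on both odd circuits, and each of them would be its component.
    x₁≁x₂ : ¬ Connected C x₁ x₂
    x₁≁x₂ c = N₁≢N₂ (trans (N₁≡ (subst (x₂ ∈V_) (sym (N₁≡ x₁∈N₁)) (∈V-own-component c)))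
                           (sym (N₂≡ x₂∈N₂)))

    x₁≢x₂ : x₁ ≢ x₂
    x₁≢x₂ eq = x₁≁x₂ (subst (Connected C x₁) eq ε)

    e∉C : e ∉ C
    e∉C e∈C = x₁≁x₂ (adjacent e∈C b ◅ ε)

    open Directed C o₂ two smooth₂
    open Rooted x₁ x₂ x₁≁x₂

    component-circuit : ∀ v → component C v CircuitOf C
    component-circuit v =
      component-isCircuit C (λ w → inj₂ (two w)) (deg-2⇒∈V C v (two v)) , component⊆ C v

    root-in : ∀ {r x} → root r ≡ r → x ∈V component C r → root x ≡ x → r ≡ x
    root-in {r} {x} isRoot x∈ isRoot′ =
      trans (sym isRoot) (trans (root-cong (∈V-component C r {w = x} x∈)) isRoot′)

    odd-component : ∀ {r} → root r ≡ r → Odd (component C r) → r ≡ x₁ ⊎ r ≡ x₂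
    odd-component {r} isRoot odd = [
      (λ eq → inj₁ (root-in {r} {x₁} isRoot (subst (x₁ ∈V_) (sym eq) x₁∈N₁) root-x₁)) ,
      (λ eq → inj₂ (root-in {r} {x₂} isRoot (subst (x₂ ∈V_) (sym eq) x₂∈N₂) root-x₂)) ]′
      (onlyOdd (component C r) (component-circuit r , odd))

    by-cases : (P : Vertex → Set) → P x₁ → P x₂ → (∀ w → w ≢ x₁ → w ≢ x₂ → P w) → ∀ w → P w
    by-cases P P₁ P₂ P₃ w = go (w ≟ x₁) (w ≟ x₂)
      where
      go : Dec (w ≡ x₁) → Dec (w ≡ x₂) → P w
      go (yes eq) _        = subst P (sym eq) P₁
      go (no _)   (yes eq) = subst P (sym eq) P₂
      go (no ≢₁)  (no ≢₂)  = P₃ w ≢₁ ≢₂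

    deg-matched-x₁ : deg matched x₁ ≡ 0
    deg-matched-x₁ = deg-matched-odd-root root-x₁ (subst Odd (N₁≡ x₁∈N₁) (proj₂ odd₁))

    deg-matched-x₂ : deg matched x₂ ≡ 0
    deg-matched-x₂ = deg-matched-odd-root root-x₂ (subst Odd (N₂≡ x₂∈N₂) (proj₂ odd₂))

    deg-matched-other : ∀ {w} → w ≢ x₁ → w ≢ x₂ → deg matched w ≡ 1
    deg-matched-other {w} w≢x₁ w≢x₂ = go (root w ≟ w) (2 ∣? ∣ component C w ∣)
      where
      go : Dec (root w ≡ w) → Dec (2 ∣ ∣ component C w ∣) → deg matched w ≡ 1
      go (no ≢w)      _          = deg-matched-nonroot ≢w
      go (yes isRoot) (yes even) = deg-matched-even-root isRoot even
      go (yes isRoot) (no odd)   =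
        ⊥-elim ([ w≢x₁ , w≢x₂ ]′ (odd-component isRoot odd))

    M⊆C : M ⊆ C
    M⊆C f∈M = p─q⊆p C _ (within f∈M)

    M-avoids : ∀ {f} → f ∈ M → f ∉ incidentEdges x₁ × f ∉ incidentEdges x₂
    M-avoids f∈M = (λ f∈ → f∉ (x∈p∪q⁺ (inj₁ f∈))) , λ f∈ → f∉ (x∈p∪q⁺ (inj₂ f∈))
      where f∉ = x∈p─q⇒x∉q C _ (within f∈M)

    deg-M-x₁ : deg (lookup M) x₁ ≡ 0
    deg-M-x₁ = deg-zero λ f c eq → ∉⇒lookup λ f∈M → proj₁ (M-avoids f∈M) (∈incident⁺ (c , eq))

    deg-M-x₂ : deg (lookup M) x₂ ≡ 0
    deg-M-x₂ = deg-zero λ f c eq → ∉⇒lookup λ f∈M → proj₂ (M-avoids f∈M) (∈incident⁺ (c , eq))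

    M′ : EdgeSet
    M′ = tabulate matched

    deg-M′ : ∀ w → deg (lookup M′) w ≡ deg matched w
    deg-M′ w = deg-cong w λ f _ _ → lookup∘tabulate matched f

    M′-matching : IsMatching M′
    M′-matching w = ≤-trans (≤-reflexive (trans (degree≡deg M′ w) (deg-M′ w)))
      (by-cases (λ v → deg matched v ≤ 1)
        (≤-trans (≤-reflexive deg-matched-x₁) z≤n)
        (≤-trans (≤-reflexive deg-matched-x₂) z≤n)
        (λ v ≢₁ ≢₂ → ≤-reflexive (deg-matched-other ≢₁ ≢₂)) w)

    M′-within : M′ ⊆ deleteVertices C x₁ x₂
    M′-within {f} f∈M′ = x∈p∧x∉q⇒x∈p─q f∈C λ f∈ →
      [ avoid deg-matched-x₁ , avoid deg-matched-x₂ ]′ (x∈p∪q⁻ _ _ f∈)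
      where
      mf : matched f ≡ true
      mf = trans (sym (lookup∘tabulate matched f)) ([]=⇒lookup f∈M′)
      f∈C : f ∈ C
      f∈C = lookup⇒[]= f C (proj₁ (∧-true mf))
      avoid : ∀ {x} → deg matched x ≡ 0 → f ∉ incidentEdges x
      avoid d≡0 f∈ = let d , eq = ∈incident⁻ f∈ in
        true≢false (trans (sym mf) (deg≡0 matched _ d≡0 f d eq))

    -- Vertex by vertex, `M` has at most the degree of the alternating matching, which misses only
    -- `x₁` and `x₂`. Maximality gives `M` at least as many edges, so the degree sums squeeze.
    deg-M : ∀ w → deg (lookup M) w ≡ deg matched w
    deg-M = ∑-squeeze deg≤ (begin
      ∑ (deg matched)                     ≡⟨ ∑-cong (sym ∘ deg-M′) ⟩
      ∑ (deg (lookup M′))                 ≡⟨ handshake (lookup M′) ⟩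
      ∑ (ι ∘ lookup M′) + ∑ (ι ∘ lookup M′) ≤⟨ +-mono-≤ M′≤M M′≤M ⟩
      ∑ (ι ∘ lookup M) + ∑ (ι ∘ lookup M) ≡⟨ handshake (lookup M) ⟨
      ∑ (deg (lookup M))                  ∎)
      where
      open ≤-Reasoning
      M′≤M : ∑ (ι ∘ lookup M′) ≤ ∑ (ι ∘ lookup M)
      M′≤M = ≤-trans (≤-reflexive (sym (card M′)))
        (≤-trans (maximum M′ M′-matching M′-within) (≤-reflexive (card M)))
      deg≤ : ∀ w → deg (lookup M) w ≤ deg matched w
      deg≤ = by-cases (λ w → deg (lookup M) w ≤ deg matched w)
        (≤-trans (≤-reflexive deg-M-x₁) z≤n)
        (≤-trans (≤-reflexive deg-M-x₂) z≤n)
        (λ w ≢₁ ≢₂ → ≤-trans (≤-reflexive (sym (degree≡deg M w)))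
          (≤-trans (matching w) (≤-reflexive (sym (deg-matched-other ≢₁ ≢₂)))))

    H : EdgeSet
    H = (∁ C - e) ∪ M

    h c : Edge → Bool
    h = lookup H
    c = lookup C

    H-outside : ∀ {f} → c f ≡ false → f ≢ e → h f ≡ true
    H-outside cf f≢e = []=⇒lookup (x∈p∪q⁺ {p = ∁ C - e}
      (inj₁ (x∈p∧x≢y⇒x∈p-y (x∉p⇒x∈∁p (lookup⇒∉ {p = C} cf)) f≢e)))

    H-matched : ∀ {f} → f ∈ M → h f ≡ true
    H-matched f∈M = []=⇒lookup (x∈p∪q⁺ {p = ∁ C - e} (inj₂ f∈M))

    H-unmatched : ∀ {f} → f ∈ C → f ∉ M → h f ≡ false
    H-unmatched f∈C f∉M = ∉⇒lookup λ f∈H →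
      [ (λ f∈ → x∈∁p⇒x∉p (p─q⊆p (∁ C) _ f∈) f∈C) , f∉M ]′ (x∈p∪q⁻ (∁ C - e) M f∈H)

    H-e : h e ≡ false
    H-e = ∉⇒lookup λ e∈H → [ (λ e∈ → x∈p─q⇒x∉q (∁ C) ⁅ e ⁆ e∈ (x∈⁅x⁆ e)) , e∉C ∘ M⊆C ]′
                              (x∈p∪q⁻ (∁ C - e) M e∈H)

    -- The indicator of `H` is that of the complement of `C`, minus that of `e`, plus that of `M`,
    -- with the negative term moved to the left.
    H-count : ∀ f → ι (h f) + ι (f == e) ≡ ι (not (c f)) + ι (lookup M f)
    H-count f = go (f ∈? C) (f ≟ e) (f ∈? M)
      where
      count : ∀ {p q r s} p′ q′ r′ s′ → p ≡ p′ → q ≡ q′ → r ≡ r′ → s ≡ s′ →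
              ι p′ + ι q′ ≡ ι (not r′) + ι s′ → ι p + ι q ≡ ι (not r) + ι s
      count _ _ _ _ refl refl refl refl eq = eq
      go : Dec (f ∈ C) → Dec (f ≡ e) → Dec (f ∈ M) →
           ι (h f) + ι (f == e) ≡ ι (not (c f)) + ι (lookup M f)
      go (yes f∈C) (yes f≡e) _ = ⊥-elim (e∉C (subst (_∈ C) f≡e f∈C))
      go (yes f∈C) (no f≢e) (yes f∈M) =
        count true false true true (H-matched f∈M) (≢⇒== f≢e) ([]=⇒lookup f∈C) ([]=⇒lookup f∈M) refl
      go (yes f∈C) (no f≢e) (no f∉M) =
        count false false true false (H-unmatched f∈C f∉M) (≢⇒== f≢e) ([]=⇒lookup f∈C) (∉⇒lookup f∉M) refl
      go (no f∉C) (yes f≡e) _ =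
        count false true false false (trans (cong h f≡e) H-e) (trans (cong (_== e) f≡e) (==-refl e))
          (∉⇒lookup f∉C) (∉⇒lookup (f∉C ∘ M⊆C)) refl
      go (no f∉C) (no f≢e) _ =
        count true false false false (H-outside (∉⇒lookup f∉C) f≢e) (≢⇒== f≢e)
          (∉⇒lookup f∉C) (∉⇒lookup (f∉C ∘ M⊆C)) refl

    -- The complement of `C` has degree 1 everywhere. Removing `e` takes this away at `x₁` and `x₂`,
    -- while `M` adds 1 at all other vertices; so `H` is 2-regular apart from these two isolated
    -- vertices.
    deg-H : ∀ w → deg h w + (ι (x₁ == w) + ι (x₂ == w)) ≡ 1 + deg (lookup M) w
    deg-H w = begin
      deg h w + (ι (x₁ == w) + ι (x₂ == w)) ≡⟨ cong (deg h w +_) (deg-single e b w) ⟨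
      deg h w + deg (_== e) w               ≡⟨ deg-balance h (_== e) (not ∘ c) (lookup M) H-count w ⟩
      deg (not ∘ c) w + deg (lookup M) w    ≡⟨ cong (_+ deg (lookup M) w) deg-complement ⟩
      1 + deg (lookup M) w                  ∎
      where
      open ≡-Reasoning
      ι-complement : ∀ f → ι (not (c f)) + ι (c f) ≡ ι true + ι false
      ι-complement f = trans (+-comm (ι (not (c f))) _) (ι-not (c f))
      deg-complement : deg (not ∘ c) w ≡ 1
      deg-complement = +-cancelʳ-≡ 2 _ 1 (begin
        deg (not ∘ c) w + 2                       ≡⟨ cong (deg (not ∘ c) w +_) (two w) ⟨
        deg (not ∘ c) w + deg c w
          ≡⟨ deg-balance (not ∘ c) c (const true) (const false) ι-complement w ⟩
        deg (const true) w + deg (const false) w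
          ≡⟨ cong₂ _+_ (deg≡3 cubic w) (deg-zero {h = const false} {w = w} λ _ _ _ → refl) ⟩
        3                                         ∎)

    deg-H-at : ∀ w {p q m} → x₁ == w ≡ p → x₂ == w ≡ q → deg (lookup M) w ≡ m →
               deg h w + (ι p + ι q) ≡ 1 + m
    deg-H-at w p≡ q≡ m≡ = trans (cong (deg h w +_) (sym (cong₂ (λ p q → ι p + ι q) p≡ q≡)))
                                (trans (deg-H w) (cong suc m≡))

    deg-H-x₁ : deg h x₁ ≡ 0
    deg-H-x₁ = +-cancelʳ-≡ 1 _ 0 (deg-H-at x₁ (==-refl x₁) (≢⇒== (x₁≢x₂ ∘ sym)) deg-M-x₁)

    deg-H-x₂ : deg h x₂ ≡ 0
    deg-H-x₂ = +-cancelʳ-≡ 1 _ 0 (deg-H-at x₂ (≢⇒== x₁≢x₂) (==-refl x₂) deg-M-x₂)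

    deg-H-other : ∀ {w} → w ≢ x₁ → w ≢ x₂ → deg h w ≡ 2
    deg-H-other {w} ≢₁ ≢₂ = trans (sym (+-identityʳ _))
      (deg-H-at w (≢⇒== (≢₁ ∘ sym)) (≢⇒== (≢₂ ∘ sym)) (trans (deg-M w) (deg-matched-other ≢₁ ≢₂)))

    deg-H-02 : ∀ w → deg h w ≡ 0 ⊎ deg h w ≡ 2
    deg-H-02 = by-cases (λ w → deg h w ≡ 0 ⊎ deg h w ≡ 2)
      (inj₁ deg-H-x₁) (inj₁ deg-H-x₂) (λ w ≢₁ ≢₂ → inj₂ (deg-H-other ≢₁ ≢₂))

    balanced-H : Balanced h o₁
    balanced-H = smooth⇒balanced H o₁ smooth₁ deg-H-02

    -- The flows f₁ + 2 f₂ and 2 f₁ − f₂, where fᵢ is the unit flow along oᵢ.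
    module Flow₁ = Combined h o₁ c o₂ (const b)
    module Flow₂ = Combined c (not ∘ o₂) h o₁ (const b)

    c-e : c e ≡ false
    c-e = ∉⇒lookup e∉C

    c-or-h : ∀ {f} → f ≢ e → h f ≡ false → c f ≡ false → ⊥
    c-or-h f≢e hf cf = true≢false (trans (sym (H-outside cf f≢e)) hf)

    flow₁ : NearlyPositiveFlow Flow₁.D Flow₁.φ e
    flow₁ = record
      { conservation = Flow₁.conserved balanced-H balanced
      ; zero-at      = cong₂ (λ x y → value x (o₁ e) y (o₂ e)) H-e c-e
      ; positive     = λ f f≢e → value-positive (h f) (o₁ f) (c f) (o₂ f) (c-or-h f≢e)
      }

    flow₂ : NearlyPositiveFlow Flow₂.D Flow₂.φ e
    flow₂ = record
      { conservation = Flow₂.conserved (balanced-reverse {h = c} {o = o₂} balanced) balanced-H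
      ; zero-at      = cong₂ (λ x y → value x (not (o₂ e)) y (o₁ e)) c-e H-e
      ; positive     = λ f f≢e → value-positive (c f) (not (o₂ f)) (h f) (o₁ f)
                                   λ cf hf → c-or-h f≢e hf cf
      }

    D₁-e : Flow₁.D e ≡ b
    D₁-e = cong₂ (λ x y → direction x (o₁ e) y (o₂ e) b) H-e c-e

    e-ends≢ : tail Flow₁.D e ≢ head Flow₁.D e
    e-ends≢ eq = x₁≢x₂ (trans (sym (cong (end e) D₁-e)) (trans eq (cong (end e ∘ not) D₁-e)))

    D₂-e : Flow₂.D e ≡ b
    D₂-e = cong₂ (λ x y → direction x (not (o₂ e)) y (o₁ e) b) c-e H-e

    -- The coefficient 2 of f₂ outweighs f₁, even where the two flows are opposed.
    D₁-C : ∀ {f} → c f ≡ true → Flow₁.D f ≡ o₂ f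
    D₁-C {f} cf = trans (cong (λ y → direction (h f) (o₁ f) y (o₂ f) b) cf) (direction-B (h f))
      where
      direction-B : ∀ a → direction a (o₁ f) true (o₂ f) b ≡ o₂ f
      direction-B true  = refl
      direction-B false = refl

    D₂-C : ∀ {f} → c f ≡ true → h f ≡ false → Flow₂.D f ≡ not (o₂ f)
    D₂-C {f} cf hf = cong₂ (λ x y → direction x (not (o₂ f)) y (o₁ f) b) cf hf

    φ₁-at : ∀ {f x y} → h f ≡ x → c f ≡ y → Flow₁.φ f ≡ value x (o₁ f) y (o₂ f)
    φ₁-at {f} = cong₂ (λ x y → value x (o₁ f) y (o₂ f))

    φ₂-at : ∀ {f x y} → h f ≡ x → c f ≡ y → Flow₂.φ f ≡ value y (not (o₂ f)) x (o₁ f)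
    φ₂-at {f} = cong₂ (λ x y → value y (not (o₂ f)) x (o₁ f))

    H-avoids : ∀ {f} → h f ≡ true → ∀ d → end f d ≢ x₁ × end f d ≢ x₂
    H-avoids {f} hf d =
      (λ eq → true≢false (trans (sym hf) (deg≡0 h x₁ deg-H-x₁ f d eq))) ,
      (λ eq → true≢false (trans (sym hf) (deg≡0 h x₂ deg-H-x₂ f d eq)))

    -- Edges of `H` meet neither end of `e`, so the two exceptional stars cannot occur.
    unit₁ : ∀ {f} → h f ≡ true → Flow₁.φ f ≡ 1 → Deletable Flow₁.D f
    unit₁ {f} hf φf = unit-deletable cec cubic flow₁ φf
      (λ eq → proj₂ (H-avoids hf (Flow₁.D f)) (trans eq (cong (end e ∘ not) D₁-e)))
      (λ eq → proj₁ (H-avoids hf (not (Flow₁.D f))) (trans eq (cong (end e) D₁-e)))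

    unit₂ : ∀ {f} → tail Flow₂.D f ≢ x₂ → head Flow₂.D f ≢ x₁ → Flow₂.φ f ≡ 1 → Deletable Flow₂.D f
    unit₂ {f} t≢ h≢ φf = unit-deletable cec cubic flow₂ φf
      (λ eq → t≢ (trans eq (cong (end e ∘ not) D₂-e)))
      (λ eq → h≢ (trans eq (cong (end e) D₂-e)))

    matching-edge : ∀ {a} → a ≢ x₁ → a ≢ x₂ → ∃[ m ] (m ∈ M × Incident m a)
    matching-edge {a} ≢₁ ≢₂ = ∈V⁻ {H = M} (1≤deg⇒∈V M a
      (≤-reflexive (sym (trans (deg-M a) (deg-matched-other ≢₁ ≢₂)))))

    loopless′ : ∀ f d → end f d ≢ end f (not d)
    loopless′ f d with x₁ ≟ end f d
    ... | no  x₁≢v = loopless cec cubic f d x₁≢v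
    ... | yes x₁≡v = loopless cec cubic f d λ x₂≡v → x₁≢x₂ (trans x₁≡v (sym x₂≡v))

    heavy : ∀ {m} → m ∈ M → o₁ m ≡ o₂ m → 3 ≤ Flow₁.φ m
    heavy {m} m∈M eq = ≤-reflexive (sym (trans (φ₁-at (H-matched m∈M) ([]=⇒lookup (M⊆C m∈M)))
      (cong (λ x → if x then 1 else 3) (trans (cong (_xor o₂ m) eq) (Bool.xor-same (o₂ m))))))

    ≢e : ∀ {f} → c f ≡ true → f ≢ e
    ≢e cf refl = true≢false (trans (sym cf) c-e)

    direct : ∀ {m a} → Incident m a → ∀ d → end m d ≡ a ⊎ end m (not d) ≡ a
    direct (false , eq) false = inj₁ eq
    direct (false , eq) true  = inj₂ eq
    direct (true  , eq) false = inj₂ eq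
    direct (true  , eq) true  = inj₁ eq

    -- Let `m` be the edge of `M` at the head `a` of `f`. It avoids `x₁`, hence is not `f`; as `f`
    -- is the one arc of `C` entering `a`, `m` leaves `a`. It lies in `Z N₁ x₁`, so the orientations
    -- agree on it and its value is 1 + 2.
    exit-x₁ : ∀ {f} → c f ≡ true → h f ≡ false → tail o₂ f ≡ x₁ → Deletable Flow₁.D f
    exit-x₁ {f} cf hf tf = go (matching-edge a≢x₁ a≢x₂)
      where
      a : Vertex
      a = head o₂ f
      f∈C : f ∈ C
      f∈C = lookup⇒[]= f C cf
      x₁~a : Connected C x₁ a
      x₁~a = subst (λ v → Connected C v a) tf (arc f∈C)
      a≢x₁ : a ≢ x₁
      a≢x₁ eq = loopless′ f (o₂ f) (trans tf (sym eq))
      a≢x₂ : a ≢ x₂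
      a≢x₂ eq = x₁≁x₂ (subst (Connected C x₁) eq x₁~a)
      go : ∃[ m ] (m ∈ M × Incident m a) → Deletable Flow₁.D f
      go (m , m∈M , inc) = double-deletable-tail cec cubic flow₁ e-ends≢
        (≢e cf) (φ₁-at hf cf)
        (trans (trans (cong (end f) (D₁-C cf)) tf) (sym (cong (end e) D₁-e)))
        (heavy m∈M (agree m (inj₁ m∈Z)))
        (trans (cong (end m) (D₁-C cm)) (trans tm (sym (cong (end f ∘ not) (D₁-C cf)))))
        (loopless′ m (Flow₁.D m))
        where
        cm : c m ≡ true
        cm = []=⇒lookup (M⊆C m∈M)
        m≢f : m ≢ f
        m≢f refl = proj₁ (M-avoids m∈M) (∈incident⁺ (o₂ f , tf))
        tm : tail o₂ m ≡ a
        tm = [ (λ eq → eq) , (λ eq → contradiction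
          (≤-trans (2≤at c (not ∘ o₂) a m≢f cm cf eq refl) (≤-reflexive (in≡1 a))) λ { (s≤s ()) }) ]′
          (direct {m} inc (o₂ m))
        m∈Z : Z N₁ x₁ m
        m∈Z = subst (m ∈_) (sym (N₁≡ x₁∈N₁)) (∈component C x₁ {b = proj₁ inc} (M⊆C m∈M)
                (subst (Connected C x₁) (sym (proj₂ inc)) x₁~a)) ,
              proj₁ (M-avoids m∈M) , a ,
              (f , subst (f ∈_) (sym (N₁≡ x₁∈N₁)) (∈component C x₁ {b = not (o₂ f)} f∈C x₁~a) ,
               o₂ f , tf , refl) ,
              ∈incident⁺ inc

    -- The mirror image: `f` is the one arc of `C` leaving `a`, so the matching edge at `a` enters
    -- it.
    entry-x₂ : ∀ {f} → c f ≡ true → h f ≡ false → head o₂ f ≡ x₂ → Deletable Flow₁.D f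
    entry-x₂ {f} cf hf ef = go (matching-edge a≢x₁ a≢x₂)
      where
      a : Vertex
      a = tail o₂ f
      f∈C : f ∈ C
      f∈C = lookup⇒[]= f C cf
      x₂~a : Connected C x₂ a
      x₂~a = subst (λ v → Connected C v a) ef (connected-sym (arc f∈C))
      a≢x₁ : a ≢ x₁
      a≢x₁ eq = x₁≁x₂ (connected-sym (subst (Connected C x₂) eq x₂~a))
      a≢x₂ : a ≢ x₂
      a≢x₂ eq = loopless′ f (o₂ f) (trans eq (sym ef))
      go : ∃[ m ] (m ∈ M × Incident m a) → Deletable Flow₁.D f
      go (m , m∈M , inc) = double-deletable-head cec cubic flow₁ e-ends≢
        (≢e cf) (φ₁-at hf cf)
        (trans (trans (cong (end f ∘ not) (D₁-C cf)) ef) (sym (cong (end e ∘ not) D₁-e)))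
        (heavy m∈M (agree m (inj₂ m∈Z)))
        (trans (cong (end m ∘ not) (D₁-C cm)) (trans hm (sym (cong (end f) (D₁-C cf)))))
        (loopless′ m (Flow₁.D m))
        where
        cm : c m ≡ true
        cm = []=⇒lookup (M⊆C m∈M)
        m≢f : m ≢ f
        m≢f refl = proj₂ (M-avoids m∈M) (∈incident⁺ (not (o₂ f) , ef))
        hm : head o₂ m ≡ a
        hm = [ (λ eq → contradiction
          (≤-trans (2≤at c o₂ a m≢f cm cf eq refl) (≤-reflexive (out≡1 a))) λ { (s≤s ()) }) , (λ eq → eq) ]′
          (direct {m} inc (o₂ m))
        m∈Z : Z N₂ x₂ m
        m∈Z = subst (m ∈_) (sym (N₂≡ x₂∈N₂)) (∈component C x₂ {b = proj₁ inc} (M⊆C m∈M)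
                (subst (Connected C x₂) (sym (proj₂ inc)) x₂~a)) ,
              proj₂ (M-avoids m∈M) , a ,
              (f , subst (f ∈_) (sym (N₂≡ x₂∈N₂)) (∈component C x₂ {b = o₂ f} f∈C x₂~a) ,
               not (o₂ f) , ef , cong (end f) (Bool.not-involutive (o₂ f))) ,
              ∈incident⁺ inc

    orientations : Fin 2 → Orientation
    orientations zero    = Flow₁.D
    orientations (suc _) = Flow₂.D

    covered : ∀ f → ∃[ i ] Deletable (orientations i) f
    covered f = go (f ≟ e) (Bool-cases (c f)) (Bool-cases (h f))
      where
      Bool-cases : ∀ x → x ≡ true ⊎ x ≡ false
      Bool-cases true  = inj₁ refl
      Bool-cases false = inj₂ refl
      opposite : ∀ p q → p xor q ≡ false → not q xor p ≡ true
      opposite true  true  _ = refl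
      opposite false false _ = refl
      matched-edge : h f ≡ true → c f ≡ true → ∀ x → o₁ f xor o₂ f ≡ x →
                     ∃[ i ] Deletable (orientations i) f
      matched-edge hf cf true  differ = zero , unit₁ hf
        (trans (φ₁-at hf cf) (cong (λ x → if x then 1 else 3) differ))
      matched-edge hf cf false same = suc zero ,
        unit₂ (proj₂ (H-avoids hf (Flow₂.D f))) (proj₁ (H-avoids hf (not (Flow₂.D f))))
          (trans (φ₂-at hf cf) (cong (λ x → if x then 1 else 3) (opposite (o₁ f) (o₂ f) same)))
      circuit-edge : h f ≡ false → c f ≡ true → Dec (tail o₂ f ≡ x₁) → Dec (head o₂ f ≡ x₂) →
                     ∃[ i ] Deletable (orientations i) f
      circuit-edge hf cf (yes tf) _        = zero , exit-x₁ cf hf tf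
      circuit-edge hf cf (no _)   (yes ef) = zero , entry-x₂ cf hf ef
      -- The second orientation reverses these edges, so leaving `x₂` or entering `x₁` there means
      -- entering `x₂` or leaving `x₁` along `o₂`.
      circuit-edge hf cf (no t≢)  (no h≢)  = suc zero , unit₂
        (λ eq → h≢ (trans (sym (cong (end f) (D₂-C cf hf))) eq))
        (λ eq → t≢ (trans (sym (trans (cong (end f ∘ not) (D₂-C cf hf))
                                      (cong (end f) (Bool.not-involutive (o₂ f))))) eq))
        (φ₂-at hf cf)
      go : Dec (f ≡ e) → c f ≡ true ⊎ c f ≡ false → h f ≡ true ⊎ h f ≡ false →
           ∃[ i ] Deletable (orientations i) f
      go (yes f≡e) _ _ = zero , subst (Deletable Flow₁.D) (sym f≡e) (zero-deletable cec cubic flow₁)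
      go (no f≢e) (inj₂ cf) (inj₂ hf) = ⊥-elim (c-or-h f≢e hf cf)
      go (no _)   (inj₂ cf) (inj₁ hf) = zero , unit₁ hf (φ₁-at hf cf)
      go (no _)   (inj₁ cf) (inj₁ hf) = matched-edge hf cf _ refl
      go (no _)   (inj₁ cf) (inj₂ hf) = circuit-edge hf cf (tail o₂ f ≟ x₁) (head o₂ f ≟ x₂)

    frank : IsFrankNumber 2
    frank = record { cover = orientations , covered ; minimal = minimal }
      where
      minimal : ∀ j → DeletableCover j → 2 ≤ j
      minimal zero (o , cov) with cov e
      ... | () , _
      minimal (suc zero) (o , cov) =
        contradiction del (no-universal-orientation cubic x₁≢x₂ e (o zero))
        where
        del : ∀ f → Deletable (o zero) f
        del f with cov f
        ... | zero , d = d
      minimal (suc (suc j)) _ = s≤s (s≤s z≤n)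

theorem3 : (G : Graph) → let open Graph G in
    CyclicallyEdgeConnected 4 →
    Cubic →
    (C : EdgeSet) → IsTwoFactor C →
    (N₁ N₂ : EdgeSet) → N₁ ≢ N₂ →
    OddCircuitOf C N₁ → OddCircuitOf C N₂ →
    (∀ N → OddCircuitOf C N → N ≡ N₁ ⊎ N ≡ N₂) →
    (e : Edge) (x₁ x₂ : Vertex) → Joins e x₁ x₂ → x₁ ∈V N₁ → x₂ ∈V N₂ →
    (M : EdgeSet) → IsMaximumMatching (deleteVertices C x₁ x₂) M →
    (o₁ o₂ : Orientation) →
    IsSmooth ((∁ C - e) ∪ M) o₁ →
    IsSmooth C o₂ →
    (∀ f → Z N₁ x₁ f ⊎ Z N₂ x₂ f → o₁ f ≡ o₂ f) →
    IsFrankNumber 2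
theorem3 G cec cubic C twoFactor N₁ N₂ N₁≢N₂ odd₁ odd₂ onlyOdd e _ _ (b , refl , refl) =
  λ x₁∈N₁ x₂∈N₂ M maxM o₁ o₂ smooth₁ smooth₂ agree →
    Theorem.Main.frank G cec cubic C twoFactor N₁ N₂ N₁≢N₂ odd₁ odd₂ onlyOdd e b
      x₁∈N₁ x₂∈N₂ M maxM o₁ o₂ smooth₁ smooth₂ agree
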